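{- Let $\beta$ and $d$ be positive integers with $d\ge \beta+2$. Then there exists a $d$-dimensional integral polytope $\mathcal{P}$ such that the coefficients of $t^{d-2},t^{d-3},\dots,t^{d-\beta-1}$ in $i(\mathcal{P},t)$ are positive, and the coefficients of $t^{d-\beta-2},t^{d-\beta-3},\dots,t^{1}$ in $i(\mathcal{P},t)$ are negative.
   Context: An integral polytope is a convex polytope all of whose vertices have integer coordinates. For an integral polytope $\mathcal{P}\subseteq\mathbb{R}^N$ of dimension $d$, $i(\mathcal{P},t)=|t\mathcal{P}\cap\mathbb{Z}^N|$ ($t$ a positive integer), where $t\mathcal{P}=\{t\alpha:\alpha\in\mathcal{P}\}$, is a polynomial in $t$ of degree $d$, called the Ehrhart polynomial of $\mathcal{P}$. -}

module Defs where

open import Data.Nat as ℕ using (ℕ; zero; suc)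
open import Data.Integer as ℤ using (ℤ; +_)
open import Data.Rational using (ℚ; 0ℚ; 1ℚ; _+_; _*_; _≤_; _/_)
open import Data.Fin using (Fin; zero; suc)
open import Data.Vec using (Vec; lookup)
open import Data.List using (List; length)
open import Data.List.Relation.Unary.Unique.Propositional using (Unique)
open import Data.List.Membership.Propositional using (_∈_)
open import Data.Product using (Σ; ∃; _×_; _,_)
open import Function.Bundles using (_⇔_)
open import Relation.Binary.PropositionalEquality using (_≡_)

ℤ→ℚ : ℤ → ℚ
ℤ→ℚ z = z / 1

ℕ→ℚ : ℕ → ℚ
ℕ→ℚ n = (+ n) / 1

sumℚ : {n : ℕ} → (Fin n → ℚ) → ℚ
sumℚ {zero}  f = 0ℚ
sumℚ {suc n} f = f zero + sumℚ (λ i → f (suc i))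

sumℚ< : ℕ → (ℕ → ℚ) → ℚ
sumℚ< zero    c = 0ℚ
sumℚ< (suc n) c = sumℚ< n c + c n

powℚ : ℚ → ℕ → ℚ
powℚ q zero    = 1ℚ
powℚ q (suc k) = q * powℚ q k

Pt : ℕ → Set
Pt N = Vec ℤ N

-- An integral polytope in ℝ^N given as the convex hull of finitely many
-- integer points  V 0, …, V (m-1).
-- x ∈ t · conv(V) : x is a convex combination (rational weights) of t·V i.
-- (For integral x and integral V, real convex weights exist iff rational ones do.)
InDilate : {N m : ℕ} → (Fin m → Pt N) → ℕ → Pt N → Set
InDilate {N} {m} V t x =
  Σ (Fin m → ℚ) λ w →
    (∀ i → 0ℚ ≤ w i) ×
    (sumℚ w ≡ 1ℚ) ×
    (∀ (j : Fin N) → ℤ→ℚ (lookup x j) ≡ sumℚ (λ i → w i * (ℕ→ℚ t * ℤ→ℚ (lookup (V i) j))))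

HasCard : {N : ℕ} → (Pt N → Set) → ℕ → Set
HasCard {N} S n =
  Σ (List (Pt N)) λ xs → Unique xs × (∀ x → (x ∈ xs) ⇔ S x) × (length xs ≡ n)

-- Affine independence (over ℚ, equivalently over ℝ for rational points)
-- of k points p 0, …, p (k-1) of ℤ^N.
AffIndep : {N k : ℕ} → (Fin k → Pt N) → Set
AffIndep {N} {k} p =
  ∀ (c : Fin k → ℚ) → sumℚ c ≡ 0ℚ →
    (∀ (j : Fin N) → sumℚ (λ i → c i * ℤ→ℚ (lookup (p i) j)) ≡ 0ℚ) →
    ∀ i → c i ≡ 0ℚ

HasDim : {N m : ℕ} → (Fin m → Pt N) → ℕ → Set
HasDim {N} {m} V d =
  (Σ (Fin (suc d) → Fin m) λ f → AffIndep (λ i → V (f i))) ×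
  (∀ (f : Fin (suc (suc d)) → Fin m) → AffIndep (λ i → V (f i)) → Data.Empty.⊥)
  where import Data.Empty

IsEhrhartPoly : {N m : ℕ} → (Fin m → Pt N) → ℕ → (ℕ → ℚ) → Set
IsEhrhartPoly V d c =
  (∀ k → d ℕ.< k → c k ≡ 0ℚ) ×
  (∀ (t : ℕ) → 1 ℕ.≤ t →
     Σ ℕ λ n → HasCard (InDilate V t) n ×
               (ℕ→ℚ n ≡ sumℚ< (suc d) (λ k → c k * powℚ (ℕ→ℚ t) k)))

{-# OPTIONS --safe #-}

-- Let T_m be the Reeve tetrahedron with vertices 0, e₁, e₂, (1,1,m).  The fibre of t T_m over (i,j)
-- has m (min(i,j) − max(0,i+j−t)) + 1 lattice points, so i(T_m,t) = (t+1)² + m (t³−t)/6.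
-- Multiplying a polytope by the segment [0,n] multiplies its Ehrhart polynomial by nt+1, and dilating it
-- by s multiplies the coefficient of t^k by s^k.  For T_m × [0,n₁] × ⋯ × [0,n_r] the coefficients have the form
-- a_k + (m−1) b_k with a_k > 0; a factor nt+1 with n large moves the negative range of b up by one degree,
-- except that b₁ stays negative, as b₀ = 0.  Taking m large gives c₁, …, c_{r+1} < 0 < c_{r+2}, c_{r+3}.
-- Finally, dilating by a large s before multiplying by [0,1] keeps the sign of every coefficient and adds
-- a positive leading one; doing this β times gives the required polytope.  If d = β + 2 a product of
-- segments will do.

module Submission where

open import Defs
open import Data.Nat as ℕ using (ℕ; zero; suc; z≤n; s≤s; _∸_; _⊓_)
import Data.Nat.Properties as ℕₚ
open import Data.Nat.Solver using () renaming (module +-*-Solver to ℕSolver)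
open import Data.Integer as ℤ using (ℤ; +≤+)
import Data.Integer.Properties as ℤₚ
open import Data.Rational hiding (_⊓_)
open import Data.Rational.Properties
open import Data.Rational.Solver
import Data.Rational.Unnormalised as ℚᵘ
import Data.Rational.Unnormalised.Properties as ℚᵘₚ
open import Data.Fin using (Fin; zero; suc; punchIn; punchOut; _↑ˡ_; _↑ʳ_; splitAt)
open import Data.Fin.Properties using (any?; punchIn-punchOut; splitAt-↑ˡ; splitAt-↑ʳ) renaming (_≟_ to _≟ᶠ_)
open import Data.List as List using (_++_)
open import Data.List.Membership.Propositional using (_∈_)
open import Data.List.Membership.Propositional.Properties using (∈-++⁺ˡ; ∈-++⁺ʳ; ∈-++⁻; ∈-map⁺; ∈-map⁻)
open import Data.List.Properties using (length-++; length-map)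
open import Data.List.Relation.Unary.All using ([])
open import Data.List.Relation.Unary.Any using (here)
open import Data.List.Relation.Unary.Unique.Propositional using ([]; _∷_)
import Data.List.Relation.Unary.Unique.Propositional.Properties as Uniqueₚ
open import Data.Product using (Σ; ∃; _×_; _,_; proj₁; proj₂)
open import Data.Sum using (_⊎_; inj₁; inj₂)
open import Data.Vec as Vec using (_∷_; []; lookup)
open import Data.Vec.Properties using (∷-injectiveʳ; ∷-injectiveˡ; lookup-map)
open import Function using (_∘_; id)
open import Function.Bundles using (_⇔_; mk⇔; Equivalence)
open import Relation.Binary using (tri<; tri≈; tri>)
open import Relation.Binary.PropositionalEquality
open import Relation.Nullary using (¬_; yes; no)
open import Relation.Nullary.Decidable using (¬?; decidable-stable)
open import Relation.Nullary.Negation using (contradiction)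
open ℕSolver using () renaming (solve to solveℕ; _:=_ to _⊜_; _:+_ to _⊕_; _:*_ to _⊗_; con to lit)
open +-*-Solver using (solve; _:=_; _:+_; _:*_; _:-_; :-_; con)

-- Rational arithmetic and finite sums

-- The obstacle is the constant term 1. Multiplying by nt + 1 adds n to the coefficient of t, so a
-- long prism over a fixed T_m would destroy the very coefficient that T_m makes negative. Hence m
-- stays free: each length n is chosen from the slopes b alone, and m is fixed only after the last
-- of them. In the slopes the problem disappears, because the constant term does not depend on m.
-- They start as 0, -1/6, 0, 1/6, and in b′_k = b_k + n b_(k-1) a negative b_(k-1) overrides
-- whatever b_k is. The last β factors use the opposite domination. After dilation by s the new
-- coefficient is s^(k-1) (s c_k + c_(k-1)), where c_k wins, even for k = 1 against the constant
-- term. With r = d - β - 2 negative coefficients wanted and r ≥ 1, the dimension splits as 3 for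
-- T_m, r - 1 for the long segments and β for the unit ones.

ℤ→ℚ-+ : ∀ a b → ℤ→ℚ (a ℤ.+ b) ≡ ℤ→ℚ a + ℤ→ℚ b
-- `_/_` normalises by a gcd; among unnormalised rationals an integer is literally a fraction over 1
-- and the identity is one of integers.
ℤ→ℚ-+ a b = toℚᵘ-injective (begin-equality
  toℚᵘ (ℤ→ℚ (a ℤ.+ b))               ≃⟨ toℚᵘ-fromℚᵘ (ℚᵘ.mkℚᵘ (a ℤ.+ b) 0) ⟩
  ℚᵘ.mkℚᵘ (a ℤ.+ b) 0                ≃⟨ ℚᵘ.*≡* (cong (ℤ._* ℤ.+ 1) (cong₂ ℤ._+_ (sym (ℤₚ.*-identityʳ a)) (sym (ℤₚ.*-identityʳ b)))) ⟩
  ℚᵘ.mkℚᵘ a 0 ℚᵘ.+ ℚᵘ.mkℚᵘ b 0       ≃⟨ ℚᵘₚ.+-cong (toℚᵘ-fromℚᵘ (ℚᵘ.mkℚᵘ a 0)) (toℚᵘ-fromℚᵘ (ℚᵘ.mkℚᵘ b 0)) ⟨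
  toℚᵘ (ℤ→ℚ a) ℚᵘ.+ toℚᵘ (ℤ→ℚ b)     ≃⟨ toℚᵘ-homo-+ (ℤ→ℚ a) (ℤ→ℚ b) ⟨
  toℚᵘ (ℤ→ℚ a + ℤ→ℚ b)               ∎)
  where open ℚᵘₚ.≤-Reasoning

ℤ→ℚ-* : ∀ a b → ℤ→ℚ (a ℤ.* b) ≡ ℤ→ℚ a * ℤ→ℚ b
ℤ→ℚ-* a b = toℚᵘ-injective (begin-equality
  toℚᵘ (ℤ→ℚ (a ℤ.* b))               ≃⟨ toℚᵘ-fromℚᵘ (ℚᵘ.mkℚᵘ (a ℤ.* b) 0) ⟩
  ℚᵘ.mkℚᵘ a 0 ℚᵘ.* ℚᵘ.mkℚᵘ b 0       ≃⟨ ℚᵘₚ.*-cong (toℚᵘ-fromℚᵘ (ℚᵘ.mkℚᵘ a 0)) (toℚᵘ-fromℚᵘ (ℚᵘ.mkℚᵘ b 0)) ⟨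
  toℚᵘ (ℤ→ℚ a) ℚᵘ.* toℚᵘ (ℤ→ℚ b)     ≃⟨ toℚᵘ-homo-* (ℤ→ℚ a) (ℤ→ℚ b) ⟨
  toℚᵘ (ℤ→ℚ a * ℤ→ℚ b)               ∎)
  where open ℚᵘₚ.≤-Reasoning

ℤ→ℚ-mono-≤ : ∀ a b → a ℤ.≤ b → ℤ→ℚ a ≤ ℤ→ℚ b
ℤ→ℚ-mono-≤ a b a≤b = toℚᵘ-cancel-≤ (begin
  toℚᵘ (ℤ→ℚ a)  ≃⟨ toℚᵘ-fromℚᵘ (ℚᵘ.mkℚᵘ a 0) ⟩
  ℚᵘ.mkℚᵘ a 0   ≤⟨ ℚᵘ.*≤* (ℤₚ.*-monoʳ-≤-nonNeg (ℤ.+ 1) a≤b) ⟩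
  ℚᵘ.mkℚᵘ b 0   ≃⟨ toℚᵘ-fromℚᵘ (ℚᵘ.mkℚᵘ b 0) ⟨
  toℚᵘ (ℤ→ℚ b)  ∎)
  where open ℚᵘₚ.≤-Reasoning

ℤ→ℚ-cancel-≤ : ∀ a b → ℤ→ℚ a ≤ ℤ→ℚ b → a ℤ.≤ b
ℤ→ℚ-cancel-≤ a b le = ℤₚ.*-cancelʳ-≤-pos a b (ℤ.+ 1) (ℚᵘₚ.drop-*≤* (begin
  ℚᵘ.mkℚᵘ a 0   ≃⟨ toℚᵘ-fromℚᵘ (ℚᵘ.mkℚᵘ a 0) ⟨
  toℚᵘ (ℤ→ℚ a)  ≤⟨ toℚᵘ-mono-≤ le ⟩
  toℚᵘ (ℤ→ℚ b)  ≃⟨ toℚᵘ-fromℚᵘ (ℚᵘ.mkℚᵘ b 0) ⟩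
  ℚᵘ.mkℚᵘ b 0   ∎))
  where open ℚᵘₚ.≤-Reasoning

ℕ→ℚ-+ : ∀ m n → ℕ→ℚ (m ℕ.+ n) ≡ ℕ→ℚ m + ℕ→ℚ n
ℕ→ℚ-+ m n = ℤ→ℚ-+ (ℤ.+ m) (ℤ.+ n)

ℕ→ℚ-* : ∀ m n → ℕ→ℚ (m ℕ.* n) ≡ ℕ→ℚ m * ℕ→ℚ n
ℕ→ℚ-* m n = trans (cong ℤ→ℚ (ℤₚ.pos-* m n)) (ℤ→ℚ-* (ℤ.+ m) (ℤ.+ n))

ℕ→ℚ-suc : ∀ n → ℕ→ℚ (suc n) ≡ 1ℚ + ℕ→ℚ n
ℕ→ℚ-suc = ℕ→ℚ-+ 1

ℕ→ℚ-mono-≤ : ∀ m n → m ℕ.≤ n → ℕ→ℚ m ≤ ℕ→ℚ n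
ℕ→ℚ-mono-≤ m n m≤n = ℤ→ℚ-mono-≤ (ℤ.+ m) (ℤ.+ n) (+≤+ m≤n)

0≤ℕ→ℚ : ∀ n → 0ℚ ≤ ℕ→ℚ n
0≤ℕ→ℚ n = ℕ→ℚ-mono-≤ 0 n z≤n

0<1 : 0ℚ < 1ℚ
0<1 = positive⁻¹ 1ℚ

0<ℕ→ℚ-suc : ∀ n → 0ℚ < ℕ→ℚ (suc n)
0<ℕ→ℚ-suc n = <-≤-trans 0<1 (ℕ→ℚ-mono-≤ 1 (suc n) (s≤s z≤n))

0<⇒≢0 : ∀ {p} → 0ℚ < p → p ≢ 0ℚ
0<⇒≢0 0<p refl = <-irrefl refl 0<p

*-nonneg : ∀ {p q} → 0ℚ ≤ p → 0ℚ ≤ q → 0ℚ ≤ p * q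
*-nonneg {p} {q} 0≤p 0≤q = nonNegative⁻¹ (p * q)
  {{nonNeg*nonNeg⇒nonNeg p {{nonNegative 0≤p}} q {{nonNegative 0≤q}}}}

+-nonneg : ∀ {p q} → 0ℚ ≤ p → 0ℚ ≤ q → 0ℚ ≤ p + q
+-nonneg = +-mono-≤

*-pos : ∀ {p q} → 0ℚ < p → 0ℚ < q → 0ℚ < p * q
*-pos {p} {q} 0<p 0<q = positive⁻¹ (p * q) {{pos*pos⇒pos p {{positive 0<p}} q {{positive 0<q}}}}

*-pos-neg : ∀ {p q} → 0ℚ < p → q < 0ℚ → p * q < 0ℚ
*-pos-neg {p} {q} 0<p q<0 = negative⁻¹ (p * q) {{pos*neg⇒neg p {{positive 0<p}} q {{negative q<0}}}}

*-cancelˡ-≡0 : ∀ {p q} → p ≢ 0ℚ → p * q ≡ 0ℚ → q ≡ 0ℚ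
*-cancelˡ-≡0 {p} {q} p≢0 pq≡0 = begin
  q                ≡⟨ *-identityˡ q ⟨
  1ℚ * q           ≡⟨ cong (_* q) (*-inverseˡ p) ⟨
  1/ p * p * q     ≡⟨ *-assoc (1/ p) p q ⟩
  1/ p * (p * q)   ≡⟨ cong (1/ p *_) pq≡0 ⟩
  1/ p * 0ℚ        ≡⟨ *-zeroʳ (1/ p) ⟩
  0ℚ               ∎
  where
  open ≡-Reasoning
  instance _ = ≢-nonZero p≢0

p≤q⇒0≤q-p : ∀ {p q} → p ≤ q → 0ℚ ≤ q - p
p≤q⇒0≤q-p {p} {q} p≤q = subst (_≤ q - p) (+-inverseʳ p) (+-monoˡ-≤ (- p) p≤q)

0≤q-p⇒p≤q : ∀ {p q} → 0ℚ ≤ q - p → p ≤ q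
0≤q-p⇒p≤q {p} {q} le = subst₂ _≤_ (+-identityˡ p)
  (solve 2 (λ p q → q :- p :+ p := q) refl p q) (+-monoˡ-≤ p le)

powℚ-pos : ∀ {q} → 0ℚ < q → ∀ k → 0ℚ < powℚ q k
powℚ-pos 0<q zero    = 0<1
powℚ-pos 0<q (suc k) = *-pos 0<q (powℚ-pos 0<q k)

powℚ-* : ∀ p q k → powℚ (p * q) k ≡ powℚ p k * powℚ q k
powℚ-* p q zero    = refl
powℚ-* p q (suc k) = trans (cong (p * q *_) (powℚ-* p q k))
  (solve 4 (λ p q x y → p :* q :* (x :* y) := p :* x :* (q :* y)) refl p q (powℚ p k) (powℚ q k))

sumℚ-cong : ∀ {n} {f g : Fin n → ℚ} → (∀ i → f i ≡ g i) → sumℚ f ≡ sumℚ g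
sumℚ-cong {zero}  f≗g = refl
sumℚ-cong {suc n} f≗g = cong₂ _+_ (f≗g zero) (sumℚ-cong (f≗g ∘ suc))

sumℚ-zero : ∀ n → sumℚ {n} (λ _ → 0ℚ) ≡ 0ℚ
sumℚ-zero zero    = refl
sumℚ-zero (suc n) = trans (+-identityˡ _) (sumℚ-zero n)

sumℚ-+ : ∀ {n} (f g : Fin n → ℚ) → sumℚ (λ i → f i + g i) ≡ sumℚ f + sumℚ g
sumℚ-+ {zero}  f g = refl
sumℚ-+ {suc n} f g = trans (cong (f zero + g zero +_) (sumℚ-+ (f ∘ suc) (g ∘ suc)))
  (solve 4 (λ a b c d → a :+ b :+ (c :+ d) := a :+ c :+ (b :+ d)) refl
    (f zero) (g zero) (sumℚ (f ∘ suc)) (sumℚ (g ∘ suc)))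

sumℚ-*ˡ : ∀ {n} a (f : Fin n → ℚ) → sumℚ (λ i → a * f i) ≡ a * sumℚ f
sumℚ-*ˡ {zero}  a f = sym (*-zeroʳ a)
sumℚ-*ˡ {suc n} a f = trans (cong (a * f zero +_) (sumℚ-*ˡ a (f ∘ suc)))
  (sym (*-distribˡ-+ a (f zero) (sumℚ (f ∘ suc))))

sumℚ-*ʳ : ∀ {n} a (f : Fin n → ℚ) → sumℚ (λ i → f i * a) ≡ sumℚ f * a
sumℚ-*ʳ a f = trans (sumℚ-cong (λ i → *-comm (f i) a)) (trans (sumℚ-*ˡ a f) (*-comm a (sumℚ f)))

sumℚ-↑ : ∀ m {n} (f : Fin (m ℕ.+ n) → ℚ) →
         sumℚ f ≡ sumℚ (λ i → f (i ↑ˡ n)) + sumℚ (λ i → f (m ↑ʳ i))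
sumℚ-↑ zero    f = sym (+-identityˡ (sumℚ f))
sumℚ-↑ (suc m) f = trans (cong (f zero +_) (sumℚ-↑ m (f ∘ suc))) (sym (+-assoc (f zero) _ _))

sumℚ-nonneg : ∀ {n} {f : Fin n → ℚ} → (∀ i → 0ℚ ≤ f i) → 0ℚ ≤ sumℚ f
sumℚ-nonneg {zero}  0≤f = ≤-refl
sumℚ-nonneg {suc n} 0≤f = +-nonneg (0≤f zero) (sumℚ-nonneg (0≤f ∘ suc))

sumℚ<-cong : ∀ n {f g : ℕ → ℚ} → (∀ k → f k ≡ g k) → sumℚ< n f ≡ sumℚ< n g
sumℚ<-cong zero    f≗g = refl
sumℚ<-cong (suc n) f≗g = cong₂ _+_ (sumℚ<-cong n f≗g) (f≗g n)

sumℚ<-+ : ∀ n (f g : ℕ → ℚ) → sumℚ< n (λ k → f k + g k) ≡ sumℚ< n f + sumℚ< n g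
sumℚ<-+ zero    f g = refl
sumℚ<-+ (suc n) f g = trans (cong (_+ (f n + g n)) (sumℚ<-+ n f g))
  (solve 4 (λ a b c d → a :+ b :+ (c :+ d) := a :+ c :+ (b :+ d)) refl
    (sumℚ< n f) (sumℚ< n g) (f n) (g n))

sumℚ<-*ˡ : ∀ n a (f : ℕ → ℚ) → sumℚ< n (λ k → a * f k) ≡ a * sumℚ< n f
sumℚ<-*ˡ zero    a f = sym (*-zeroʳ a)
sumℚ<-*ˡ (suc n) a f = trans (cong (_+ a * f n) (sumℚ<-*ˡ n a f))
  (sym (*-distribˡ-+ a (sumℚ< n f) (f n)))

sumℚ<-front : ∀ n (f : ℕ → ℚ) → sumℚ< (suc n) f ≡ f 0 + sumℚ< n (f ∘ suc)
sumℚ<-front zero    f = trans (+-identityˡ (f 0)) (sym (+-identityʳ (f 0)))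
sumℚ<-front (suc n) f = trans (cong (_+ f (suc n)) (sumℚ<-front n f))
  (+-assoc (f 0) (sumℚ< n (f ∘ suc)) (f (suc n)))

-- Affine independence and lattice point counts

-- Gaussian elimination: a nonzero entry `p` of the first vector clears coordinate `p` from the
-- others, which leaves one vector and one coordinate fewer. If the first vector is zero, it is a
-- dependence by itself.
linearlyDependent : ∀ k (v : Fin (suc k) → Fin k → ℚ) →
  Σ (Fin (suc k) → ℚ) λ c → (∃ λ i → c i ≢ 0ℚ) × (∀ j → sumℚ (λ i → c i * v i j) ≡ 0ℚ)
linearlyDependent zero    v = (λ _ → 1ℚ) , (zero , λ ()) , λ ()
linearlyDependent (suc k) v with any? (λ j → ¬? (v zero j ≟ 0ℚ))
... | no v₀≡0 = c , (zero , λ ()) , vanishes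
  where
  c : Fin (suc (suc k)) → ℚ
  c zero    = 1ℚ
  c (suc _) = 0ℚ
  vanishes : ∀ j → sumℚ (λ i → c i * v i j) ≡ 0ℚ
  vanishes j = cong₂ _+_
    (trans (*-identityˡ _) (decidable-stable (v zero j ≟ 0ℚ) (λ v₀ⱼ≢0 → v₀≡0 (j , v₀ⱼ≢0))))
    (trans (sumℚ-cong (λ i → *-zeroˡ (v (suc i) j))) (sumℚ-zero (suc k)))
... | yes (p , v₀ₚ≢0) = c , (suc (proj₁ i≢0) , proj₂ i≢0) , vanishes
  where
  instance _ = ≢-nonZero v₀ₚ≢0
  r : Fin (suc k) → ℚ
  r i = v (suc i) p * 1/ v zero p
  u : Fin (suc k) → Fin (suc k) → ℚ
  u i j = v (suc i) j - r i * v zero j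
  u-pivot : ∀ i → u i p ≡ 0ℚ
  u-pivot i = begin
    v (suc i) p - v (suc i) p * 1/ v zero p * v zero p    ≡⟨ cong (λ x → v (suc i) p - x) (*-assoc (v (suc i) p) (1/ v zero p) (v zero p)) ⟩
    v (suc i) p - v (suc i) p * (1/ v zero p * v zero p)  ≡⟨ cong (λ x → v (suc i) p - v (suc i) p * x) (*-inverseˡ (v zero p)) ⟩
    v (suc i) p - v (suc i) p * 1ℚ                        ≡⟨ solve 1 (λ x → x :- x :* con 1ℚ := con 0ℚ) refl (v (suc i) p) ⟩
    0ℚ                                                    ∎
    where open ≡-Reasoning
  ih = linearlyDependent k (λ i j → u i (punchIn p j))
  c′ = proj₁ ih
  i≢0 = proj₁ (proj₂ ih)
  u-vanishes : ∀ j → sumℚ (λ i → c′ i * u i j) ≡ 0ℚ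
  -- Coordinate `p` was cleared from every `u i`; every other coordinate is a `punchIn p` and so is
  -- covered by the induction hypothesis.
  u-vanishes j with p ≟ᶠ j
  ... | yes refl = trans (sumℚ-cong (λ i → trans (cong (c′ i *_) (u-pivot i)) (*-zeroʳ (c′ i)))) (sumℚ-zero (suc k))
  ... | no p≢j   = subst (λ x → sumℚ (λ i → c′ i * u i x) ≡ 0ℚ) (punchIn-punchOut p≢j) (proj₂ (proj₂ ih) (punchOut p≢j))
  c : Fin (suc (suc k)) → ℚ
  -- Pays back the multiples of the first vector that were subtracted in forming `u`.
  c zero    = - sumℚ (λ i → c′ i * r i)
  c (suc i) = c′ i
  vanishes : ∀ j → sumℚ (λ i → c i * v i j) ≡ 0ℚ
  vanishes j = begin
    - R * v₀ + sumℚ (λ i → c′ i * v (suc i) j)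
      ≡⟨ cong (_+ V) (solve 2 (λ R v₀ → (:- R) :* v₀ := R :* (:- v₀)) refl R v₀) ⟩
    R * - v₀ + V
      ≡⟨ cong (_+ V) (sumℚ-*ʳ (- v₀) (λ i → c′ i * r i)) ⟨
    sumℚ (λ i → c′ i * r i * - v₀) + V
      ≡⟨ sumℚ-+ (λ i → c′ i * r i * - v₀) (λ i → c′ i * v (suc i) j) ⟨
    sumℚ (λ i → c′ i * r i * - v₀ + c′ i * v (suc i) j)
      ≡⟨ sumℚ-cong (λ i → solve 4 (λ a b x y → a :* b :* (:- x) :+ a :* y := a :* (y :- b :* x)) refl
           (c′ i) (r i) v₀ (v (suc i) j)) ⟩
    sumℚ (λ i → c′ i * u i j)
      ≡⟨ u-vanishes j ⟩
    0ℚ ∎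
    where
    open ≡-Reasoning
    R = sumℚ (λ i → c′ i * r i)
    V = sumℚ (λ i → c′ i * v (suc i) j)
    v₀ = v zero j

-- Homogenisation: with a coordinate 1 put in front, an affine dependence is a linear one, and d + 2
-- vectors in dimension d + 1 always have one.
¬affIndep : ∀ d (p : Fin (suc (suc d)) → Pt d) → ¬ AffIndep p
¬affIndep d p indep =
  let c , (i , cᵢ≢0) , vanishes = linearlyDependent (suc d) v in
  cᵢ≢0 (indep c (trans (sumℚ-cong (λ i → sym (*-identityʳ (c i)))) (vanishes zero)) (vanishes ∘ suc) i)
  where
  v : Fin (suc (suc d)) → Fin (suc d) → ℚ
  v i zero    = 1ℚ
  v i (suc j) = ℤ→ℚ (lookup (p i) j)

affIndep-resp : ∀ {N k} {p q : Fin k → Pt N} → (∀ i → p i ≡ q i) → AffIndep p → AffIndep q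
affIndep-resp p≗q indep c Σc≡0 vanishes = indep c Σc≡0 (λ j →
  trans (sumℚ-cong (λ i → cong (λ x → c i * ℤ→ℚ (lookup x j)) (p≗q i))) (vanishes j))

affIndep-scale : ∀ {N k} s (p : Fin k → Pt N) → AffIndep p →
                 AffIndep (λ i → Vec.map (ℤ.+ suc s ℤ.*_) (p i))
affIndep-scale s p indep c Σc≡0 vanishes = indep c Σc≡0 (λ j →
  *-cancelˡ-≡0 (0<⇒≢0 (0<ℕ→ℚ-suc s)) (begin
    S * sumℚ (λ i → c i * X i j)    ≡⟨ sumℚ-*ˡ S (λ i → c i * X i j) ⟨
    sumℚ (λ i → S * (c i * X i j))  ≡⟨ sumℚ-cong (λ i → scaled i j) ⟩
    sumℚ (λ i → c i * ℤ→ℚ (lookup (Vec.map (ℤ.+ suc s ℤ.*_) (p i)) j)) ≡⟨ vanishes j ⟩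
    0ℚ ∎))
  where
  open ≡-Reasoning
  S = ℕ→ℚ (suc s)
  X : ∀ i j → ℚ
  X i j = ℤ→ℚ (lookup (p i) j)
  scaled : ∀ i j → S * (c i * X i j) ≡ c i * ℤ→ℚ (lookup (Vec.map (ℤ.+ suc s ℤ.*_) (p i)) j)
  scaled i j = begin
    S * (c i * X i j)  ≡⟨ solve 3 (λ s c x → s :* (c :* x) := c :* (s :* x)) refl S (c i) (X i j) ⟩
    c i * (S * X i j)  ≡⟨ cong (c i *_) (ℤ→ℚ-* (ℤ.+ suc s) (lookup (p i) j)) ⟨
    c i * ℤ→ℚ (ℤ.+ suc s ℤ.* lookup (p i) j) ≡⟨ cong (λ x → c i * ℤ→ℚ x) (lookup-map j (ℤ.+ suc s ℤ.*_) (p i)) ⟨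
    c i * ℤ→ℚ (lookup (Vec.map (ℤ.+ suc s ℤ.*_) (p i)) j) ∎

-- A base at height 0 and a single lifted vertex are enough to span the prism affinely.
prismVertices : ∀ {N k} → ℕ → (Fin (suc k) → Pt N) → Fin (suc (suc k)) → Pt (suc N)
prismVertices n p zero    = ℤ.+ n ∷ p zero
prismVertices n p (suc i) = ℤ.+ 0 ∷ p i

-- Only the lifted vertex has a nonzero first coordinate, which forces its coefficient to vanish;
-- what remains is a relation among the base points.
affIndep-prism : ∀ {N} k n (p : Fin (suc k) → Pt N) →
                 AffIndep p → AffIndep (prismVertices (suc n) p)
affIndep-prism k n p indep c Σc≡0 vanishes = λ { zero → c₀≡0 ; (suc i) → indep (c ∘ suc) Σc′≡0 vanishes′ i }
  where
  open ≡-Reasoning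
  n′ = ℕ→ℚ (suc n)
  tail≡0 : sumℚ (λ i → c (suc i) * 0ℚ) ≡ 0ℚ
  tail≡0 = trans (sumℚ-cong (λ i → *-zeroʳ (c (suc i)))) (sumℚ-zero (suc k))
  c₀≡0 : c zero ≡ 0ℚ
  c₀≡0 = *-cancelˡ-≡0 (0<⇒≢0 (0<ℕ→ℚ-suc n)) (begin
    n′ * c zero                                 ≡⟨ *-comm n′ (c zero) ⟩
    c zero * n′                                 ≡⟨ +-identityʳ (c zero * n′) ⟨
    c zero * n′ + 0ℚ                            ≡⟨ cong (c zero * n′ +_) tail≡0 ⟨
    c zero * n′ + sumℚ (λ i → c (suc i) * 0ℚ)   ≡⟨ vanishes zero ⟩
    0ℚ ∎)
  drop₀ : ∀ x {y} → c zero * x + y ≡ 0ℚ → y ≡ 0ℚ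
  drop₀ x {y} eq = begin
    y                ≡⟨ solve 2 (λ x y → y := con 0ℚ :* x :+ y) refl x y ⟩
    0ℚ * x + y       ≡⟨ cong (λ c → c * x + y) c₀≡0 ⟨
    c zero * x + y   ≡⟨ eq ⟩
    0ℚ ∎
  Σc′≡0 : sumℚ (c ∘ suc) ≡ 0ℚ
  Σc′≡0 = drop₀ 1ℚ (trans (cong (_+ sumℚ (c ∘ suc)) (*-identityʳ (c zero))) Σc≡0)
  vanishes′ : ∀ j → sumℚ (λ i → c (suc i) * ℤ→ℚ (lookup (p i) j)) ≡ 0ℚ
  vanishes′ j = drop₀ (ℤ→ℚ (lookup (p zero) j)) (vanishes (suc j))

-- Counting lattice points fibre by fibre

sumℕ : ℕ → (ℕ → ℕ) → ℕ
sumℕ zero    f = 0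
sumℕ (suc n) f = f 0 ℕ.+ sumℕ n (f ∘ suc)

sumℕ-const : ∀ n a → sumℕ n (λ _ → a) ≡ n ℕ.* a
sumℕ-const zero    a = refl
sumℕ-const (suc n) a = cong (a ℕ.+_) (sumℕ-const n a)

hasCard-resp : ∀ {N n} {S T : Pt N → Set} → (∀ x → S x ⇔ T x) → HasCard S n → HasCard T n
hasCard-resp S⇔T (xs , unique , ∈⇔S , len) = xs , unique , ∈⇔T , len
  where
  ∈⇔T : ∀ x → (x ∈ xs) ⇔ _
  ∈⇔T x = mk⇔ (Equivalence.to (S⇔T x) ∘ Equivalence.to (∈⇔S x))
              (Equivalence.from (∈⇔S x) ∘ Equivalence.from (S⇔T x))

hasCard-[] : {S : Pt 0 → Set} → S [] → HasCard S 1
hasCard-[] s = List.[ [] ] , [] ∷ [] , (λ { [] → mk⇔ (λ _ → s) (λ _ → here refl) }) , refl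

-- The list is the concatenation of the fibres over φ 0, φ 1, ..., disjoint because φ is injective.
-- Taking φ arbitrary lets the induction shift it, and lets a fibre start at a height other than 0.
hasCard-fibres : ∀ {N} (φ : ℕ → ℤ) → (∀ {i j} → φ i ≡ φ j → i ≡ j) →
  ∀ k (T : ℕ → Pt N → Set) (f : ℕ → ℕ) → (∀ i → i ℕ.< k → HasCard (T i) (f i)) →
  HasCard (λ v → Σ ℕ λ i → i ℕ.< k × Σ (Pt N) λ p → v ≡ φ i ∷ p × T i p) (sumℕ k f)
hasCard-fibres φ inj zero T f card = List.[] , [] , (λ _ → mk⇔ (λ ()) (λ ())) , refl
hasCard-fibres {N} φ inj (suc k) T f card
  with card 0 (s≤s z≤n)
     | hasCard-fibres (φ ∘ suc) (ℕₚ.suc-injective ∘ inj) k (T ∘ suc) (f ∘ suc) (λ i i<k → card (suc i) (s≤s i<k))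
... | ys , uniqueʸ , ∈⇔y , lenʸ | zs , uniqueᶻ , ∈⇔z , lenᶻ =
  List.map (φ 0 ∷_) ys ++ zs ,
  Uniqueₚ.++⁺ (Uniqueₚ.map⁺ ∷-injectiveʳ uniqueʸ) uniqueᶻ disjoint ,
  (λ v → mk⇔ (to v) (from v)) ,
  trans (length-++ (List.map (φ 0 ∷_) ys)) (cong₂ ℕ._+_ (trans (length-map (φ 0 ∷_) ys) lenʸ) lenᶻ)
  where
  disjoint : ∀ {v} → ¬ (v ∈ List.map (φ 0 ∷_) ys × v ∈ zs)
  disjoint (v∈ys , v∈zs) with ∈-map⁻ (φ 0 ∷_) v∈ys | Equivalence.to (∈⇔z _) v∈zs
  ... | p , _ , refl | i , _ , q , eq , _ with inj (∷-injectiveˡ eq)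
  ... | ()
  to : ∀ v → v ∈ List.map (φ 0 ∷_) ys ++ zs → Σ ℕ λ i → i ℕ.< suc k × Σ (Pt N) λ p → v ≡ φ i ∷ p × T i p
  to v v∈ with ∈-++⁻ (List.map (φ 0 ∷_) ys) v∈
  ... | inj₁ v∈ys = let p , p∈ , eq = ∈-map⁻ (φ 0 ∷_) v∈ys in
                    0 , s≤s z≤n , p , eq , Equivalence.to (∈⇔y p) p∈
  ... | inj₂ v∈zs = let i , i<k , p , eq , t = Equivalence.to (∈⇔z v) v∈zs in
                    suc i , s≤s i<k , p , eq , t
  from : ∀ v → (Σ ℕ λ i → i ℕ.< suc k × Σ (Pt N) λ p → v ≡ φ i ∷ p × T i p) → v ∈ List.map (φ 0 ∷_) ys ++ zs
  from v (zero  , _       , p , refl , t) = ∈-++⁺ˡ (∈-map⁺ (φ 0 ∷_) (Equivalence.from (∈⇔y p) t))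
  from v (suc i , s≤s i<k , p , eq   , t) = ∈-++⁺ʳ _ (Equivalence.from (∈⇔z v) (i , i<k , p , eq , t))

hasCard-∷ : ∀ {N} {S : Pt (suc N) → Set} (φ : ℕ → ℤ) → (∀ {i j} → φ i ≡ φ j → i ≡ j) →
  ∀ k (f : ℕ → ℕ) → (∀ i → i ℕ.< k → HasCard (λ p → S (φ i ∷ p)) (f i)) →
  (∀ z p → S (z ∷ p) → ∃ λ i → i ℕ.< k × z ≡ φ i) → HasCard S (sumℕ k f)
hasCard-∷ {S = S} φ inj k f card bounded =
  hasCard-resp
    (λ { (z ∷ p) → mk⇔ (λ { (i , _ , _ , refl , s) → s })
                       (λ s → let i , i<k , z≡ = bounded z p s in
                              i , i<k , p , cong (_∷ p) z≡ , subst (λ z → S (z ∷ p)) z≡ s) })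
    (hasCard-fibres φ inj k (λ i p → S (φ i ∷ p)) f card)

-- Closure properties of full-dimensional Ehrhart polynomials

-- The ambient dimension equals d, so the upper bound on the dimension is automatic by `¬affIndep`
-- and only d + 1 independent vertices are carried along.
IsFullDimEhrhart : (d : ℕ) → (ℕ → ℚ) → Set
IsFullDimEhrhart d c = Σ ℕ λ m → Σ (Fin m → Pt d) λ V →
  (Σ (Fin (suc d) → Fin m) λ f → AffIndep (λ i → V (f i))) × IsEhrhartPoly V d c

ehrhart-resp : ∀ {d} {c c′ : ℕ → ℚ} → (∀ k → c k ≡ c′ k) → IsFullDimEhrhart d c → IsFullDimEhrhart d c′
ehrhart-resp {d} {c} {c′} c≗c′ (m , V , indep , degree , count) =
  m , V , indep , (λ k d<k → trans (sym (c≗c′ k)) (degree k d<k)) ,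
  λ t 1≤t → let n , card , eq = count t 1≤t in
    n , card , trans eq (sumℚ<-cong (suc d) (λ k → cong (_* powℚ (ℕ→ℚ t) k) (c≗c′ k)))

ehrhart-point : IsFullDimEhrhart 0 (λ { zero → 1ℚ ; (suc _) → 0ℚ })
ehrhart-point = 1 , (λ _ → []) , ((λ i → i) , indep) , (λ { (suc k) _ → refl }) ,
  λ t _ → 1 , hasCard-[] ((λ _ → 1ℚ) , (λ _ → <⇒≤ 0<1) , refl , λ ()) , refl
  where
  indep : AffIndep {0} {1} (λ _ → [])
  indep c Σc≡0 _ zero = trans (sym (+-identityʳ (c zero))) Σc≡0

-- The same weights serve both sides, as dilating the vertices or the parameter yields the same
-- generating points.
inDilate-scale : ∀ {N m} (V : Fin m → Pt N) s t x →
  InDilate V (suc s ℕ.* t) x ⇔ InDilate (λ i → Vec.map (ℤ.+ suc s ℤ.*_) (V i)) t x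
inDilate-scale V s t x = mk⇔
  (λ (w , 0≤w , Σw≡1 , x≡) → w , 0≤w , Σw≡1 , λ j → trans (x≡ j) (sumℚ-cong (λ i → cong (w i *_) (scaled i j))))
  (λ (w , 0≤w , Σw≡1 , x≡) → w , 0≤w , Σw≡1 , λ j → trans (x≡ j) (sumℚ-cong (λ i → cong (w i *_) (sym (scaled i j)))))
  where
  open ≡-Reasoning
  scaled : ∀ i j → ℕ→ℚ (suc s ℕ.* t) * ℤ→ℚ (lookup (V i) j) ≡
                   ℕ→ℚ t * ℤ→ℚ (lookup (Vec.map (ℤ.+ suc s ℤ.*_) (V i)) j)
  scaled i j = begin
    ℕ→ℚ (suc s ℕ.* t) * v            ≡⟨ cong (_* v) (ℕ→ℚ-* (suc s) t) ⟩
    ℕ→ℚ (suc s) * ℕ→ℚ t * v          ≡⟨ solve 3 (λ s t v → s :* t :* v := t :* (s :* v)) refl (ℕ→ℚ (suc s)) (ℕ→ℚ t) v ⟩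
    ℕ→ℚ t * (ℕ→ℚ (suc s) * v)        ≡⟨ cong (ℕ→ℚ t *_) (ℤ→ℚ-* (ℤ.+ suc s) (lookup (V i) j)) ⟨
    ℕ→ℚ t * ℤ→ℚ (ℤ.+ suc s ℤ.* lookup (V i) j) ≡⟨ cong (λ z → ℕ→ℚ t * ℤ→ℚ z) (lookup-map j (ℤ.+ suc s ℤ.*_) (V i)) ⟨
    ℕ→ℚ t * ℤ→ℚ (lookup (Vec.map (ℤ.+ suc s ℤ.*_) (V i)) j) ∎
    where v = ℤ→ℚ (lookup (V i) j)

ehrhart-scale : ∀ {d c} s → IsFullDimEhrhart d c → IsFullDimEhrhart d (λ k → powℚ (ℕ→ℚ (suc s)) k * c k)
ehrhart-scale {d} {c} s (m , V , (f , indep) , degree , count) =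
  m , (λ i → Vec.map (ℤ.+ suc s ℤ.*_) (V i)) ,
  (f , affIndep-scale s (V ∘ f) indep) ,
  (λ k d<k → trans (cong (powℚ S k *_) (degree k d<k)) (*-zeroʳ (powℚ S k))) ,
  λ t 1≤t → let n , card , eq = count (suc s ℕ.* t) (ℕₚ.≤-trans 1≤t (ℕₚ.m≤m+n t _)) in
    n , hasCard-resp (inDilate-scale V s t) card , trans eq (sumℚ<-cong (suc d) (term t))
  where
  S = ℕ→ℚ (suc s)
  term : ∀ t k → c k * powℚ (ℕ→ℚ (suc s ℕ.* t)) k ≡ powℚ S k * c k * powℚ (ℕ→ℚ t) k
  term t k = trans
    (cong (c k *_) (trans (cong (λ q → powℚ q k) (ℕ→ℚ-* (suc s) t)) (powℚ-* S (ℕ→ℚ t) k)))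
    (solve 3 (λ c x y → c :* (x :* y) := x :* c :* y) refl (c k) (powℚ S k) (powℚ (ℕ→ℚ t) k))

-- Prisms over an integral polytope

bounded⇒pos : ∀ {n} z → ℤ.+ 0 ℤ.≤ z → z ℤ.≤ ℤ.+ n → ∃ λ i → i ℕ.< suc n × z ≡ ℤ.+ i
bounded⇒pos (ℤ.+ i) _ (+≤+ i≤n) = i , s≤s i≤n , refl

module _ {N m : ℕ} (V : Fin m → Pt N) (h : ℕ) where

  prismVertex : Fin m ⊎ Fin m → Pt (suc N)
  prismVertex (inj₁ i) = ℤ.+ suc h ∷ V i
  prismVertex (inj₂ i) = ℤ.+ 0 ∷ V i

  prism : Fin (m ℕ.+ m) → Pt (suc N)
  prism k = prismVertex (splitAt m k)

  sumℚ-splitAt : (w : Fin (m ℕ.+ m) → ℚ) (F : Fin m ⊎ Fin m → ℚ) →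
    sumℚ (λ k → w k * F (splitAt m k)) ≡
    sumℚ (λ i → w (i ↑ˡ m) * F (inj₁ i)) + sumℚ (λ i → w (m ↑ʳ i) * F (inj₂ i))
  sumℚ-splitAt w F = trans (sumℚ-↑ m (λ k → w k * F (splitAt m k))) (cong₂ _+_
    (sumℚ-cong (λ i → cong (λ s → w (i ↑ˡ m) * F s) (splitAt-↑ˡ m i m)))
    (sumℚ-cong (λ i → cong (λ s → w (m ↑ʳ i) * F s) (splitAt-↑ʳ m m i))))

  module _ (t : ℕ) where

    private
      τ : ℚ
      τ = ℕ→ℚ t

    -- Adding the weights of the two copies of each vertex gives weights for the base. The height is
    -- the total weight `L` of the upper copy times t(h+1), and `L + R ≡ 1` confines it.
    inDilate-prism⁻ : ∀ {y x} → InDilate prism t (y ∷ x) →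
      ℤ.+ 0 ℤ.≤ y × y ℤ.≤ ℤ.+ (t ℕ.* suc h) × InDilate V t x
    inDilate-prism⁻ {y} {x} (w , 0≤w , Σw≡1 , eq) =
      ℤ→ℚ-cancel-≤ (ℤ.+ 0) y 0≤y , ℤ→ℚ-cancel-≤ y (ℤ.+ (t ℕ.* suc h)) y≤th ,
      (λ i → l i + r i) , (λ i → +-nonneg (0≤w (i ↑ˡ m)) (0≤w (m ↑ʳ i))) ,
      trans (sumℚ-+ l r) L+R≡1 , base
      where
      open ≡-Reasoning
      l r : Fin m → ℚ
      l i = w (i ↑ˡ m)
      r i = w (m ↑ʳ i)
      L = sumℚ l
      R = sumℚ r
      th = ℕ→ℚ (t ℕ.* suc h)
      L+R≡1 : L + R ≡ 1ℚ
      L+R≡1 = trans (sym (sumℚ-↑ m w)) Σw≡1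
      0≤L : 0ℚ ≤ L
      0≤L = sumℚ-nonneg (λ i → 0≤w (i ↑ˡ m))
      0≤R : 0ℚ ≤ R
      0≤R = sumℚ-nonneg (λ i → 0≤w (m ↑ʳ i))
      0≤th : 0ℚ ≤ th
      0≤th = 0≤ℕ→ℚ (t ℕ.* suc h)
      y≡L*th : ℤ→ℚ y ≡ L * th
      y≡L*th = begin
        ℤ→ℚ y
          ≡⟨ eq zero ⟩
        sumℚ (λ k → w k * (τ * ℤ→ℚ (lookup (prism k) zero)))
          ≡⟨ sumℚ-splitAt w (λ s → τ * ℤ→ℚ (lookup (prismVertex s) zero)) ⟩
        sumℚ (λ i → l i * (τ * ℕ→ℚ (suc h))) + sumℚ (λ i → r i * (τ * 0ℚ))
          ≡⟨ cong₂ _+_ (sumℚ-*ʳ (τ * ℕ→ℚ (suc h)) l) (sumℚ-*ʳ (τ * 0ℚ) r) ⟩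
        L * (τ * ℕ→ℚ (suc h)) + R * (τ * 0ℚ)
          ≡⟨ cong (λ q → L * q + R * (τ * 0ℚ)) (sym (ℕ→ℚ-* t (suc h))) ⟩
        L * th + R * (τ * 0ℚ)
          ≡⟨ solve 4 (λ L th R τ → L :* th :+ R :* (τ :* con 0ℚ) := L :* th) refl L th R τ ⟩
        L * th ∎
      0≤y : 0ℚ ≤ ℤ→ℚ y
      0≤y = subst (0ℚ ≤_) (sym y≡L*th) (*-nonneg 0≤L 0≤th)
      th-y≡R*th : R * th ≡ th - ℤ→ℚ y
      th-y≡R*th = begin
        R * th                     ≡⟨ solve 3 (λ L R th → R :* th := (L :+ R) :* th :- L :* th) refl L R th ⟩
        (L + R) * th - L * th      ≡⟨ cong₂ (λ p q → p * th - q) L+R≡1 (sym y≡L*th) ⟩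
        1ℚ * th - ℤ→ℚ y            ≡⟨ cong (_- ℤ→ℚ y) (*-identityˡ th) ⟩
        th - ℤ→ℚ y                 ∎
      y≤th : ℤ→ℚ y ≤ th
      y≤th = 0≤q-p⇒p≤q (subst (0ℚ ≤_) th-y≡R*th (*-nonneg 0≤R 0≤th))
      base : ∀ j → ℤ→ℚ (lookup x j) ≡ sumℚ (λ i → (l i + r i) * (τ * ℤ→ℚ (lookup (V i) j)))
      base j = begin
        ℤ→ℚ (lookup x j)
          ≡⟨ eq (suc j) ⟩
        sumℚ (λ k → w k * (τ * ℤ→ℚ (lookup (prism k) (suc j))))
          ≡⟨ sumℚ-splitAt w (λ s → τ * ℤ→ℚ (lookup (prismVertex s) (suc j))) ⟩
        sumℚ (λ i → l i * v i) + sumℚ (λ i → r i * v i)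
          ≡⟨ sumℚ-+ (λ i → l i * v i) (λ i → r i * v i) ⟨
        sumℚ (λ i → l i * v i + r i * v i)
          ≡⟨ sumℚ-cong (λ i → sym (*-distribʳ-+ (v i) (l i) (r i))) ⟩
        sumℚ (λ i → (l i + r i) * v i) ∎
        where
        v : Fin m → ℚ
        v i = τ * ℤ→ℚ (lookup (V i) j)

    -- Each weight is divided between the upper and the lower copy in the ratio a : 1 - a, with a =
    -- y / (t(h+1)) producing the height y.
    inDilate-prism⁺ : 1 ℕ.≤ t → ∀ {y x} → y ℕ.≤ t ℕ.* suc h → InDilate V t x →
      InDilate prism t (ℤ.+ y ∷ x)
    inDilate-prism⁺ 1≤t {y} {x} y≤th (w , 0≤w , Σw≡1 , eq) =
      (λ k → W (splitAt m k)) , (λ k → 0≤W (splitAt m k)) , ΣW≡1 ,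
      λ { zero → top ; (suc j) → base j }
      where
      open ≡-Reasoning
      th = ℕ→ℚ (t ℕ.* suc h)
      0<th : 0ℚ < th
      0<th = <-≤-trans 0<1 (ℕ→ℚ-mono-≤ 1 (t ℕ.* suc h) (ℕₚ.*-mono-≤ 1≤t (s≤s z≤n)))
      instance
        th-pos : Positive th
        th-pos = positive 0<th
        th-nonZero : NonZero th
        th-nonZero = pos⇒nonZero th
      0≤1/th : 0ℚ ≤ 1/ th
      0≤1/th = <⇒≤ (positive⁻¹ (1/ th) {{1/pos⇒pos th}})
      a b : ℚ
      a = ℕ→ℚ y * 1/ th
      b = 1ℚ - a
      0≤a : 0ℚ ≤ a
      0≤a = *-nonneg (0≤ℕ→ℚ y) 0≤1/th
      0≤b : 0ℚ ≤ b
      0≤b = subst (0ℚ ≤_)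
        (trans (solve 3 (λ th y i → (th :- y) :* i := th :* i :- y :* i) refl th (ℕ→ℚ y) (1/ th))
               (cong (_- a) (*-inverseʳ th)))
        (*-nonneg (p≤q⇒0≤q-p (ℕ→ℚ-mono-≤ y (t ℕ.* suc h) y≤th)) 0≤1/th)
      W : Fin m ⊎ Fin m → ℚ
      W (inj₁ i) = a * w i
      W (inj₂ i) = b * w i
      0≤W : ∀ s → 0ℚ ≤ W s
      0≤W (inj₁ i) = *-nonneg 0≤a (0≤w i)
      0≤W (inj₂ i) = *-nonneg 0≤b (0≤w i)
      split : (F : Fin m ⊎ Fin m → ℚ) → sumℚ (λ k → W (splitAt m k) * F (splitAt m k)) ≡
              a * sumℚ (λ i → w i * F (inj₁ i)) + b * sumℚ (λ i → w i * F (inj₂ i))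
      split F = begin
        sumℚ (λ k → W (splitAt m k) * F (splitAt m k))
          ≡⟨ sumℚ-splitAt (λ k → W (splitAt m k)) F ⟩
        sumℚ (λ i → W (splitAt m (i ↑ˡ m)) * F (inj₁ i)) + sumℚ (λ i → W (splitAt m (m ↑ʳ i)) * F (inj₂ i))
          ≡⟨ cong₂ _+_
               (sumℚ-cong (λ i → trans (cong (λ s → W s * F (inj₁ i)) (splitAt-↑ˡ m i m)) (*-assoc a (w i) (F (inj₁ i)))))
               (sumℚ-cong (λ i → trans (cong (λ s → W s * F (inj₂ i)) (splitAt-↑ʳ m m i)) (*-assoc b (w i) (F (inj₂ i))))) ⟩
        sumℚ (λ i → a * (w i * F (inj₁ i))) + sumℚ (λ i → b * (w i * F (inj₂ i)))
          ≡⟨ cong₂ _+_ (sumℚ-*ˡ a (λ i → w i * F (inj₁ i))) (sumℚ-*ˡ b (λ i → w i * F (inj₂ i))) ⟩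
        a * sumℚ (λ i → w i * F (inj₁ i)) + b * sumℚ (λ i → w i * F (inj₂ i)) ∎
      Σw*≡ : ∀ q → sumℚ (λ i → w i * q) ≡ q
      Σw*≡ q = trans (sumℚ-*ʳ q w) (trans (cong (_* q) Σw≡1) (*-identityˡ q))
      ΣW≡1 : sumℚ (λ k → W (splitAt m k)) ≡ 1ℚ
      ΣW≡1 = begin
        sumℚ (λ k → W (splitAt m k))        ≡⟨ sumℚ-cong (λ k → sym (*-identityʳ (W (splitAt m k)))) ⟩
        sumℚ (λ k → W (splitAt m k) * 1ℚ)   ≡⟨ split (λ _ → 1ℚ) ⟩
        a * sumℚ (λ i → w i * 1ℚ) + b * sumℚ (λ i → w i * 1ℚ) ≡⟨ cong (λ q → a * q + b * q) (Σw*≡ 1ℚ) ⟩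
        a * 1ℚ + b * 1ℚ                     ≡⟨ solve 1 (λ a → a :* con 1ℚ :+ (con 1ℚ :- a) :* con 1ℚ := con 1ℚ) refl a ⟩
        1ℚ                                  ∎
      top : ℕ→ℚ y ≡ sumℚ (λ k → W (splitAt m k) * (τ * ℤ→ℚ (lookup (prism k) zero)))
      top = sym (begin
        sumℚ (λ k → W (splitAt m k) * (τ * ℤ→ℚ (lookup (prism k) zero)))
          ≡⟨ split (λ s → τ * ℤ→ℚ (lookup (prismVertex s) zero)) ⟩
        a * sumℚ (λ i → w i * (τ * ℕ→ℚ (suc h))) + b * sumℚ (λ i → w i * (τ * 0ℚ))
          ≡⟨ cong₂ (λ p q → a * p + b * q) (Σw*≡ (τ * ℕ→ℚ (suc h))) (Σw*≡ (τ * 0ℚ)) ⟩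
        a * (τ * ℕ→ℚ (suc h)) + b * (τ * 0ℚ)
          ≡⟨ cong (λ p → a * p + b * (τ * 0ℚ)) (sym (ℕ→ℚ-* t (suc h))) ⟩
        ℕ→ℚ y * 1/ th * th + b * (τ * 0ℚ)
          ≡⟨ solve 5 (λ y i th b τ → y :* i :* th :+ b :* (τ :* con 0ℚ) := y :* (i :* th)) refl (ℕ→ℚ y) (1/ th) th b τ ⟩
        ℕ→ℚ y * (1/ th * th)
          ≡⟨ cong (ℕ→ℚ y *_) (*-inverseˡ th) ⟩
        ℕ→ℚ y * 1ℚ
          ≡⟨ *-identityʳ (ℕ→ℚ y) ⟩
        ℕ→ℚ y ∎)
      base : ∀ j → ℤ→ℚ (lookup x j) ≡ sumℚ (λ k → W (splitAt m k) * (τ * ℤ→ℚ (lookup (prism k) (suc j))))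
      base j = sym (begin
        sumℚ (λ k → W (splitAt m k) * (τ * ℤ→ℚ (lookup (prism k) (suc j))))
          ≡⟨ split (λ s → τ * ℤ→ℚ (lookup (prismVertex s) (suc j))) ⟩
        a * v + b * v
          ≡⟨ solve 2 (λ a v → a :* v :+ (con 1ℚ :- a) :* v := v) refl a v ⟩
        v
          ≡⟨ eq j ⟨
        ℤ→ℚ (lookup x j) ∎)
        where v = sumℚ (λ i → w i * (τ * ℤ→ℚ (lookup (V i) j)))

    hasCard-prism : 1 ℕ.≤ t → ∀ {n} → HasCard (InDilate V t) n →
                    HasCard (InDilate prism t) (suc (t ℕ.* suc h) ℕ.* n)
    hasCard-prism 1≤t {n} card =
      subst (HasCard (InDilate prism t)) (sumℕ-const (suc (t ℕ.* suc h)) n)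
        (hasCard-∷ {S = InDilate prism t} ℤ.+_ ℤₚ.+-injective (suc (t ℕ.* suc h)) (λ _ → n)
          (λ i i< → hasCard-resp
            (λ x → mk⇔ (inDilate-prism⁺ 1≤t (ℕₚ.≤-pred i<)) (λ ∈prism → proj₂ (proj₂ (inDilate-prism⁻ ∈prism))))
            card)
          bounded)
      where
      bounded : ∀ z x → InDilate prism t (z ∷ x) → ∃ λ i → i ℕ.< suc (t ℕ.* suc h) × z ≡ ℤ.+ i
      bounded z x ∈prism = let 0≤z , z≤th , _ = inDilate-prism⁻ ∈prism in bounded⇒pos z 0≤z z≤th

-- Coefficients of the product of the polynomial `c` with (h+1)t + 1.
prismCoeff : ℕ → (ℕ → ℚ) → ℕ → ℚ
prismCoeff h c zero    = c zero
prismCoeff h c (suc k) = c (suc k) + ℕ→ℚ (suc h) * c k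

ehrhart-prism : ∀ {d c} h → IsFullDimEhrhart d c → IsFullDimEhrhart (suc d) (prismCoeff h c)
ehrhart-prism {d} {c} h (m , V , (f , indep) , degree , count) =
  m ℕ.+ m , prism V h , (f′ , affIndep-resp vertices (affIndep-prism d h (V ∘ f) indep)) ,
  degree′ ,
  λ t 1≤t → let n , card , eq = count t 1≤t in
    suc (t ℕ.* suc h) ℕ.* n , hasCard-prism V h t 1≤t card , evaluate t n eq
  where
  f′ : Fin (suc (suc d)) → Fin (m ℕ.+ m)
  f′ zero    = f zero ↑ˡ m
  f′ (suc i) = m ↑ʳ f i
  vertices : ∀ i → prismVertices (suc h) (V ∘ f) i ≡ prism V h (f′ i)
  vertices zero    = cong (prismVertex V h) (sym (splitAt-↑ˡ m (f zero) m))
  vertices (suc i) = cong (prismVertex V h) (sym (splitAt-↑ʳ m m (f i)))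
  H = ℕ→ℚ (suc h)
  degree′ : ∀ k → suc d ℕ.< k → prismCoeff h c k ≡ 0ℚ
  degree′ (suc k) (s≤s d<k) = trans
    (cong₂ (λ p q → p + H * q) (degree (suc k) (ℕₚ.m<n⇒m<1+n d<k)) (degree k d<k))
    (solve 1 (λ h → con 0ℚ :+ h :* con 0ℚ := con 0ℚ) refl H)
  evaluate : ∀ t n → ℕ→ℚ n ≡ sumℚ< (suc d) (λ k → c k * powℚ (ℕ→ℚ t) k) →
    ℕ→ℚ (suc (t ℕ.* suc h) ℕ.* n) ≡ sumℚ< (suc (suc d)) (λ k → prismCoeff h c k * powℚ (ℕ→ℚ t) k)
  evaluate t n eq = begin
    ℕ→ℚ (suc (t ℕ.* suc h) ℕ.* n)
      ≡⟨ ℕ→ℚ-* (suc (t ℕ.* suc h)) n ⟩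
    ℕ→ℚ (suc (t ℕ.* suc h)) * ℕ→ℚ n
      ≡⟨ cong₂ _*_ (trans (ℕ→ℚ-suc (t ℕ.* suc h)) (cong (1ℚ +_) (ℕ→ℚ-* t (suc h)))) eq ⟩
    (1ℚ + q * H) * E
      -- The added 0 makes room for the vanishing coefficient of degree d + 1, so that the sum gets
      -- the length of the target and can be split at its front.
      ≡⟨ solve 2 (λ th e → (con 1ℚ :+ th) :* e := e :+ con 0ℚ :+ th :* e) refl (q * H) E ⟩
    E + 0ℚ + q * H * E
      ≡⟨ cong (λ x → E + x + q * H * E)
           (trans (cong (_* powℚ q (suc d)) (degree (suc d) ℕₚ.≤-refl)) (*-zeroˡ (powℚ q (suc d)))) ⟨
    sumℚ< (suc (suc d)) (λ k → c k * powℚ q k) + q * H * E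
      ≡⟨ cong (_+ q * H * E) (sumℚ<-front (suc d) (λ k → c k * powℚ q k)) ⟩
    c 0 * 1ℚ + E₁ + q * H * E
      ≡⟨ +-assoc (c 0 * 1ℚ) E₁ (q * H * E) ⟩
    c 0 * 1ℚ + (E₁ + q * H * E)
      ≡⟨ cong (λ x → c 0 * 1ℚ + (E₁ + x)) (sumℚ<-*ˡ (suc d) (q * H) (λ k → c k * powℚ q k)) ⟨
    c 0 * 1ℚ + (E₁ + sumℚ< (suc d) (λ k → q * H * (c k * powℚ q k)))
      ≡⟨ cong (c 0 * 1ℚ +_) (sumℚ<-+ (suc d) (λ k → c (suc k) * powℚ q (suc k)) (λ k → q * H * (c k * powℚ q k))) ⟨
    c 0 * 1ℚ + sumℚ< (suc d) (λ k → c (suc k) * powℚ q (suc k) + q * H * (c k * powℚ q k))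
      ≡⟨ cong (c 0 * 1ℚ +_) (sumℚ<-cong (suc d) (λ k →
           solve 5 (λ t h a b p → a :* (t :* p) :+ t :* h :* (b :* p) := (a :+ h :* b) :* (t :* p)) refl
             q H (c (suc k)) (c k) (powℚ q k))) ⟩
    c 0 * 1ℚ + sumℚ< (suc d) (λ k → prismCoeff h c (suc k) * powℚ q (suc k))
      ≡⟨ sumℚ<-front (suc d) (λ k → prismCoeff h c k * powℚ q k) ⟨
    sumℚ< (suc (suc d)) (λ k → prismCoeff h c k * powℚ q k) ∎
    where
    open ≡-Reasoning
    q = ℕ→ℚ t
    E = sumℚ< (suc d) (λ k → c k * powℚ q k)
    E₁ = sumℚ< (suc d) (λ k → c (suc k) * powℚ q (suc k))

-- Power sums for the tetrahedron

sumℕ-cong : ∀ n {f g : ℕ → ℕ} → (∀ i → i ℕ.< n → f i ≡ g i) → sumℕ n f ≡ sumℕ n g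
sumℕ-cong zero    f≗g = refl
sumℕ-cong (suc n) f≗g = cong₂ ℕ._+_ (f≗g 0 (s≤s z≤n)) (sumℕ-cong n (λ i i<n → f≗g (suc i) (s≤s i<n)))

sumℕ-+ : ∀ n (f g : ℕ → ℕ) → sumℕ n (λ i → f i ℕ.+ g i) ≡ sumℕ n f ℕ.+ sumℕ n g
sumℕ-+ zero    f g = refl
sumℕ-+ (suc n) f g = trans (cong (f 0 ℕ.+ g 0 ℕ.+_) (sumℕ-+ n (f ∘ suc) (g ∘ suc)))
  (solveℕ 4 (λ a b c d → a ⊕ b ⊕ (c ⊕ d) ⊜ a ⊕ c ⊕ (b ⊕ d)) refl
    (f 0) (g 0) (sumℕ n (f ∘ suc)) (sumℕ n (g ∘ suc)))

sumℕ-*ˡ : ∀ n a (f : ℕ → ℕ) → sumℕ n (λ i → a ℕ.* f i) ≡ a ℕ.* sumℕ n f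
sumℕ-*ˡ zero    a f = sym (ℕₚ.*-zeroʳ a)
sumℕ-*ˡ (suc n) a f = trans (cong (a ℕ.* f 0 ℕ.+_) (sumℕ-*ˡ n a (f ∘ suc)))
  (sym (ℕₚ.*-distribˡ-+ a (f 0) (sumℕ n (f ∘ suc))))

sumℕ-snoc : ∀ n (f : ℕ → ℕ) → sumℕ (suc n) f ≡ sumℕ n f ℕ.+ f n
sumℕ-snoc zero    f = ℕₚ.+-identityʳ (f 0)
sumℕ-snoc (suc n) f = trans (cong (f 0 ℕ.+_) (sumℕ-snoc n (f ∘ suc)))
  (sym (ℕₚ.+-assoc (f 0) (sumℕ n (f ∘ suc)) (f (suc n))))

sumℕ-reverse : ∀ n (f : ℕ → ℕ) → sumℕ (suc n) f ≡ sumℕ (suc n) (λ i → f (n ∸ i))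
sumℕ-reverse zero    f = refl
sumℕ-reverse (suc n) f = begin
  f 0 ℕ.+ sumℕ (suc n) (f ∘ suc)
    ≡⟨ cong (f 0 ℕ.+_) (sumℕ-reverse n (f ∘ suc)) ⟩
  f 0 ℕ.+ sumℕ (suc n) (λ i → f (suc (n ∸ i)))
    ≡⟨ ℕₚ.+-comm (f 0) _ ⟩
  sumℕ (suc n) (λ i → f (suc (n ∸ i))) ℕ.+ f 0
    ≡⟨ cong₂ ℕ._+_
         (sumℕ-cong (suc n) (λ i i<1+n → cong f (sym (ℕₚ.+-∸-assoc 1 (ℕₚ.≤-pred i<1+n)))))
         (cong f (sym (ℕₚ.n∸n≡0 (suc n)))) ⟩
  sumℕ (suc n) (λ i → f (suc n ∸ i)) ℕ.+ f (suc n ∸ suc n)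
    ≡⟨ sumℕ-snoc (suc n) (λ i → f (suc n ∸ i)) ⟨
  sumℕ (suc (suc n)) (λ i → f (suc n ∸ i)) ∎
  where open ≡-Reasoning

sumℕ² : ℕ → (ℕ → ℕ → ℕ) → ℕ
sumℕ² n f = sumℕ n (λ i → sumℕ n (f i))

sumℕ²-cong : ∀ n {f g : ℕ → ℕ → ℕ} → (∀ i j → i ℕ.< n → j ℕ.< n → f i j ≡ g i j) →
             sumℕ² n f ≡ sumℕ² n g
sumℕ²-cong n f≗g = sumℕ-cong n (λ i i<n → sumℕ-cong n (λ j j<n → f≗g i j i<n j<n))

sumℕ²-+ : ∀ n (f g : ℕ → ℕ → ℕ) → sumℕ² n (λ i j → f i j ℕ.+ g i j) ≡ sumℕ² n f ℕ.+ sumℕ² n g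
sumℕ²-+ n f g = trans (sumℕ-cong n (λ i _ → sumℕ-+ n (f i) (g i)))
                      (sumℕ-+ n (λ i → sumℕ n (f i)) (λ i → sumℕ n (g i)))

sumℕ²-*ˡ : ∀ n a (f : ℕ → ℕ → ℕ) → sumℕ² n (λ i j → a ℕ.* f i j) ≡ a ℕ.* sumℕ² n f
sumℕ²-*ˡ n a f = trans (sumℕ-cong n (λ i _ → sumℕ-*ˡ n a (f i))) (sumℕ-*ˡ n a (λ i → sumℕ n (f i)))

sumℕ²-1 : ∀ n → sumℕ² n (λ _ _ → 1) ≡ n ℕ.* n
sumℕ²-1 n = trans (sumℕ-cong n (λ _ _ → trans (sumℕ-const n 1) (ℕₚ.*-identityʳ n))) (sumℕ-const n n)

sumℕ-suc : ∀ n → 2 ℕ.* sumℕ n suc ≡ n ℕ.* n ℕ.+ n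
sumℕ-suc zero    = refl
sumℕ-suc (suc n) = begin
  2 ℕ.* (1 ℕ.+ sumℕ n (λ i → 1 ℕ.+ suc i))
    ≡⟨ cong (λ x → 2 ℕ.* (1 ℕ.+ x)) (trans (sumℕ-+ n (λ _ → 1) suc) (cong (ℕ._+ sumℕ n suc) (sumℕ-const n 1))) ⟩
  2 ℕ.* (1 ℕ.+ (n ℕ.* 1 ℕ.+ sumℕ n suc))
    ≡⟨ solveℕ 2 (λ n s → lit 2 ⊗ (lit 1 ⊕ (n ⊗ lit 1 ⊕ s)) ⊜ lit 2 ⊕ lit 2 ⊗ n ⊕ lit 2 ⊗ s) refl n (sumℕ n suc) ⟩
  2 ℕ.+ 2 ℕ.* n ℕ.+ 2 ℕ.* sumℕ n suc
    ≡⟨ cong (2 ℕ.+ 2 ℕ.* n ℕ.+_) (sumℕ-suc n) ⟩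
  2 ℕ.+ 2 ℕ.* n ℕ.+ (n ℕ.* n ℕ.+ n)
    ≡⟨ solveℕ 1 (λ n → lit 2 ⊕ lit 2 ⊗ n ⊕ (n ⊗ n ⊕ n) ⊜ (lit 1 ⊕ n) ⊗ (lit 1 ⊕ n) ⊕ (lit 1 ⊕ n)) refl n ⟩
  suc n ℕ.* suc n ℕ.+ suc n ∎
  where open ≡-Reasoning

-- The value is the square pyramidal number (n-1)n(2n-1)/6, written without subtraction or division.
-- Row 0 and column 0 contribute nothing, and elsewhere the minimum drops by 1 when both indices do.
sumℕ²-⊓ : ∀ n → 6 ℕ.* sumℕ² n _⊓_ ℕ.+ 3 ℕ.* (n ℕ.* n) ≡ 2 ℕ.* (n ℕ.* n ℕ.* n) ℕ.+ n
sumℕ²-⊓ zero    = refl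
sumℕ²-⊓ (suc n) = begin
  6 ℕ.* sumℕ² (suc n) _⊓_ ℕ.+ 3 ℕ.* (suc n ℕ.* suc n)
    ≡⟨ cong (λ x → 6 ℕ.* x ℕ.+ 3 ℕ.* (suc n ℕ.* suc n)) peel ⟩
  6 ℕ.* (n ℕ.* n ℕ.+ sumℕ² n _⊓_) ℕ.+ 3 ℕ.* (suc n ℕ.* suc n)
    ≡⟨ solveℕ 2 (λ n s → lit 6 ⊗ (n ⊗ n ⊕ s) ⊕ lit 3 ⊗ ((lit 1 ⊕ n) ⊗ (lit 1 ⊕ n)) ⊜
                        lit 6 ⊗ s ⊕ lit 3 ⊗ (n ⊗ n) ⊕ (lit 6 ⊗ (n ⊗ n) ⊕ lit 6 ⊗ n ⊕ lit 3)) refl n (sumℕ² n _⊓_) ⟩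
  6 ℕ.* sumℕ² n _⊓_ ℕ.+ 3 ℕ.* (n ℕ.* n) ℕ.+ (6 ℕ.* (n ℕ.* n) ℕ.+ 6 ℕ.* n ℕ.+ 3)
    ≡⟨ cong (ℕ._+ (6 ℕ.* (n ℕ.* n) ℕ.+ 6 ℕ.* n ℕ.+ 3)) (sumℕ²-⊓ n) ⟩
  2 ℕ.* (n ℕ.* n ℕ.* n) ℕ.+ n ℕ.+ (6 ℕ.* (n ℕ.* n) ℕ.+ 6 ℕ.* n ℕ.+ 3)
    ≡⟨ solveℕ 1 (λ n → lit 2 ⊗ (n ⊗ n ⊗ n) ⊕ n ⊕ (lit 6 ⊗ (n ⊗ n) ⊕ lit 6 ⊗ n ⊕ lit 3) ⊜
                      lit 2 ⊗ ((lit 1 ⊕ n) ⊗ (lit 1 ⊕ n) ⊗ (lit 1 ⊕ n)) ⊕ (lit 1 ⊕ n)) refl n ⟩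
  2 ℕ.* (suc n ℕ.* suc n ℕ.* suc n) ℕ.+ suc n ∎
  where
  open ≡-Reasoning
  peel : sumℕ² (suc n) _⊓_ ≡ n ℕ.* n ℕ.+ sumℕ² n _⊓_
  peel = begin
    sumℕ n (λ _ → 0) ℕ.+ sumℕ² n (λ i j → 1 ℕ.+ i ⊓ j)
      ≡⟨ cong₂ ℕ._+_ (trans (sumℕ-const n 0) (ℕₚ.*-zeroʳ n)) (sumℕ²-+ n (λ _ _ → 1) _⊓_) ⟩
    sumℕ² n (λ _ _ → 1) ℕ.+ sumℕ² n _⊓_
      ≡⟨ cong (ℕ._+ sumℕ² n _⊓_) (sumℕ²-1 n) ⟩
    n ℕ.* n ℕ.+ sumℕ² n _⊓_ ∎

-- A tetrahedral number, (n³ - n)/6. Row 0 vanishes, column 0 contributes 1 + ⋯ + n, and the rest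
-- depends only on the difference of the indices.
sumℕ²-∸ : ∀ n → 6 ℕ.* sumℕ² n _∸_ ℕ.+ n ≡ n ℕ.* n ℕ.* n
sumℕ²-∸ zero    = refl
sumℕ²-∸ (suc n) = begin
  6 ℕ.* sumℕ² (suc n) _∸_ ℕ.+ suc n
    ≡⟨ cong (λ x → 6 ℕ.* x ℕ.+ suc n) peel ⟩
  6 ℕ.* (sumℕ n suc ℕ.+ sumℕ² n _∸_) ℕ.+ suc n
    ≡⟨ solveℕ 3 (λ n s d → lit 6 ⊗ (s ⊕ d) ⊕ (lit 1 ⊕ n) ⊜ lit 3 ⊗ (lit 2 ⊗ s) ⊕ (lit 6 ⊗ d ⊕ n) ⊕ lit 1)
         refl n (sumℕ n suc) (sumℕ² n _∸_) ⟩
  3 ℕ.* (2 ℕ.* sumℕ n suc) ℕ.+ (6 ℕ.* sumℕ² n _∸_ ℕ.+ n) ℕ.+ 1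
    ≡⟨ cong₂ (λ x y → 3 ℕ.* x ℕ.+ y ℕ.+ 1) (sumℕ-suc n) (sumℕ²-∸ n) ⟩
  3 ℕ.* (n ℕ.* n ℕ.+ n) ℕ.+ n ℕ.* n ℕ.* n ℕ.+ 1
    ≡⟨ solveℕ 1 (λ n → lit 3 ⊗ (n ⊗ n ⊕ n) ⊕ n ⊗ n ⊗ n ⊕ lit 1 ⊜
                      (lit 1 ⊕ n) ⊗ (lit 1 ⊕ n) ⊗ (lit 1 ⊕ n)) refl n ⟩
  suc n ℕ.* suc n ℕ.* suc n ∎
  where
  open ≡-Reasoning
  peel : sumℕ² (suc n) _∸_ ≡ sumℕ n suc ℕ.+ sumℕ² n _∸_
  peel = cong₂ ℕ._+_ (trans (sumℕ-const n 0) (ℕₚ.*-zeroʳ n))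
                     (sumℕ-+ n suc (λ i → sumℕ n (λ j → i ∸ j)))

-- Length of the segment above (i,j) in the t-th dilate of conv(0, e₁, e₂, (1,1,1)).
tetHeight : ℕ → ℕ → ℕ → ℕ
tetHeight t i j = i ⊓ j ∸ (i ℕ.+ j ∸ t)

-- Makes the outer truncated subtraction in `tetHeight` exact on the square 0 ≤ i, j ≤ t.
excess≤⊓ : ∀ {t i j} → i ℕ.≤ t → j ℕ.≤ t → i ℕ.+ j ∸ t ℕ.≤ i ⊓ j
excess≤⊓ {t} {i} {j} i≤t j≤t = ℕₚ.⊓-glb
  (ℕₚ.m≤n+o⇒m∸n≤o (i ℕ.+ j) t (subst (i ℕ.+ j ℕ.≤_) (ℕₚ.+-comm i t) (ℕₚ.+-monoʳ-≤ i j≤t)))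
  (ℕₚ.m≤n+o⇒m∸n≤o (i ℕ.+ j) t (ℕₚ.+-monoˡ-≤ j i≤t))

-- Σ min(i,j) and Σ max(0,i+j−t) are evaluated separately, the latter after reflecting j to t − j.
sumℕ²-tetHeight : ∀ t → 6 ℕ.* sumℕ² (suc t) (tetHeight t) ℕ.+ t ≡ t ℕ.* t ℕ.* t
-- The terms to be subtracted are added to both sides instead, so both closed forms apply within ℕ.
sumℕ²-tetHeight t = ℕₚ.+-cancelʳ-≡ (6 ℕ.* D ℕ.+ n ℕ.+ 3 ℕ.* (n ℕ.* n)) _ _ (begin
  6 ℕ.* W ℕ.+ t ℕ.+ (6 ℕ.* D ℕ.+ n ℕ.+ 3 ℕ.* (n ℕ.* n))
    ≡⟨ solveℕ 4 (λ w d t n → lit 6 ⊗ w ⊕ t ⊕ (lit 6 ⊗ d ⊕ n ⊕ lit 3 ⊗ (n ⊗ n)) ⊜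
                            lit 6 ⊗ (w ⊕ d) ⊕ lit 3 ⊗ (n ⊗ n) ⊕ (t ⊕ n)) refl W D t n ⟩
  6 ℕ.* (W ℕ.+ D) ℕ.+ 3 ℕ.* (n ℕ.* n) ℕ.+ (t ℕ.+ n)
    ≡⟨ cong (λ x → 6 ℕ.* x ℕ.+ 3 ℕ.* (n ℕ.* n) ℕ.+ (t ℕ.+ n)) W+D≡M ⟩
  6 ℕ.* sumℕ² n _⊓_ ℕ.+ 3 ℕ.* (n ℕ.* n) ℕ.+ (t ℕ.+ n)
    ≡⟨ cong (ℕ._+ (t ℕ.+ n)) (sumℕ²-⊓ n) ⟩
  2 ℕ.* (n ℕ.* n ℕ.* n) ℕ.+ n ℕ.+ (t ℕ.+ n)
    ≡⟨ solveℕ 1 (λ t → let n = lit 1 ⊕ t in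
         lit 2 ⊗ (n ⊗ n ⊗ n) ⊕ n ⊕ (t ⊕ n) ⊜ t ⊗ t ⊗ t ⊕ (n ⊗ n ⊗ n ⊕ lit 3 ⊗ (n ⊗ n))) refl t ⟩
  t ℕ.* t ℕ.* t ℕ.+ (n ℕ.* n ℕ.* n ℕ.+ 3 ℕ.* (n ℕ.* n))
    ≡⟨ cong (λ x → t ℕ.* t ℕ.* t ℕ.+ (x ℕ.+ 3 ℕ.* (n ℕ.* n))) (sumℕ²-∸ n) ⟨
  t ℕ.* t ℕ.* t ℕ.+ (6 ℕ.* D ℕ.+ n ℕ.+ 3 ℕ.* (n ℕ.* n)) ∎)
  where
  open ≡-Reasoning
  n = suc t
  W = sumℕ² n (tetHeight t)
  D = sumℕ² n _∸_
  reflected : sumℕ² n (λ i j → i ℕ.+ j ∸ t) ≡ D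
  reflected = sumℕ-cong n (λ i _ → trans (sumℕ-reverse t (λ j → i ℕ.+ j ∸ t))
    (sumℕ-cong n (λ j j<n → cancel i j (ℕₚ.≤-pred j<n))))
    where
    cancel : ∀ i j → j ℕ.≤ t → i ℕ.+ (t ∸ j) ∸ t ≡ i ∸ j
    cancel i j j≤t = begin
      i ℕ.+ (t ∸ j) ∸ t                  ≡⟨ cong (i ℕ.+ (t ∸ j) ∸_) (ℕₚ.m∸n+n≡m j≤t) ⟨
      i ℕ.+ (t ∸ j) ∸ (t ∸ j ℕ.+ j)      ≡⟨ cong (_∸ (t ∸ j ℕ.+ j)) (ℕₚ.+-comm i (t ∸ j)) ⟩
      t ∸ j ℕ.+ i ∸ (t ∸ j ℕ.+ j)        ≡⟨ ℕₚ.[m+n]∸[m+o]≡n∸o (t ∸ j) i j ⟩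
      i ∸ j                              ∎
  W+D≡M : W ℕ.+ D ≡ sumℕ² n _⊓_
  W+D≡M = begin
    W ℕ.+ D                                                   ≡⟨ cong (W ℕ.+_) reflected ⟨
    W ℕ.+ sumℕ² n (λ i j → i ℕ.+ j ∸ t)                       ≡⟨ sumℕ²-+ n (tetHeight t) (λ i j → i ℕ.+ j ∸ t) ⟨
    sumℕ² n (λ i j → tetHeight t i j ℕ.+ (i ℕ.+ j ∸ t))       ≡⟨ sumℕ²-cong n (λ i j i<n j<n →
                                                                    ℕₚ.m∸n+n≡m (excess≤⊓ (ℕₚ.≤-pred i<n) (ℕₚ.≤-pred j<n))) ⟩
    sumℕ² n _⊓_                                               ∎

-- The tetrahedron

-- T_m with m = μ + 1, so every natural number μ gives a nondegenerate tetrahedron.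
tet : ℕ → Fin 4 → Pt 3
tet μ zero                   = ℤ.+ 0 ∷ ℤ.+ 0 ∷ ℤ.+ 0 ∷ []
tet μ (suc zero)             = ℤ.+ 1 ∷ ℤ.+ 0 ∷ ℤ.+ 0 ∷ []
tet μ (suc (suc zero))       = ℤ.+ 0 ∷ ℤ.+ 1 ∷ ℤ.+ 0 ∷ []
tet μ (suc (suc (suc zero))) = ℤ.+ 1 ∷ ℤ.+ 1 ∷ ℤ.+ suc μ ∷ []

-- Back substitution: the third coordinate isolates c₃, the first two then give c₁ and c₂, and the
-- sum gives c₀.
affIndep-tet : ∀ μ → AffIndep (tet μ)
affIndep-tet μ c Σc≡0 vanishes = λ
  { zero → c₀≡0 ; (suc zero) → c₁≡0 ; (suc (suc zero)) → c₂≡0 ; (suc (suc (suc zero))) → c₃≡0 }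
  where
  open ≡-Reasoning
  M c₀ c₁ c₂ c₃ : ℚ
  M  = ℕ→ℚ (suc μ)
  c₀ = c zero
  c₁ = c (suc zero)
  c₂ = c (suc (suc zero))
  c₃ = c (suc (suc (suc zero)))
  c₃≡0 : c₃ ≡ 0ℚ
  c₃≡0 = *-cancelˡ-≡0 (0<⇒≢0 (0<ℕ→ℚ-suc μ)) (trans
    (solve 5 (λ M a b c d → M :* d := a :* con 0ℚ :+ (b :* con 0ℚ :+ (c :* con 0ℚ :+ (d :* M :+ con 0ℚ)))) refl M c₀ c₁ c₂ c₃)
    (vanishes (suc (suc zero))))
  c₂≡0 : c₂ ≡ 0ℚ
  c₂≡0 = begin
    c₂        ≡⟨ solve 4 (λ a b c d → c := a :* con 0ℚ :+ (b :* con 0ℚ :+ (c :* con 1ℚ :+ (d :* con 1ℚ :+ con 0ℚ))) :- d) refl c₀ c₁ c₂ c₃ ⟩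
    c₀ * 0ℚ + (c₁ * 0ℚ + (c₂ * 1ℚ + (c₃ * 1ℚ + 0ℚ))) - c₃
              ≡⟨ cong₂ _-_ (vanishes (suc zero)) c₃≡0 ⟩
    0ℚ        ∎
  c₁≡0 : c₁ ≡ 0ℚ
  c₁≡0 = begin
    c₁        ≡⟨ solve 4 (λ a b c d → b := a :* con 0ℚ :+ (b :* con 1ℚ :+ (c :* con 0ℚ :+ (d :* con 1ℚ :+ con 0ℚ))) :- d) refl c₀ c₁ c₂ c₃ ⟩
    c₀ * 0ℚ + (c₁ * 1ℚ + (c₂ * 0ℚ + (c₃ * 1ℚ + 0ℚ))) - c₃
              ≡⟨ cong₂ _-_ (vanishes zero) c₃≡0 ⟩
    0ℚ        ∎
  c₀≡0 : c₀ ≡ 0ℚ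
  c₀≡0 = begin
    c₀
      ≡⟨ solve 4 (λ a b c d → a := a :+ (b :+ (c :+ (d :+ con 0ℚ))) :- (b :+ (c :+ d))) refl c₀ c₁ c₂ c₃ ⟩
    c₀ + (c₁ + (c₂ + (c₃ + 0ℚ))) - (c₁ + (c₂ + c₃))
      ≡⟨ cong₂ _-_ Σc≡0 (cong₂ _+_ c₁≡0 (cong₂ _+_ c₂≡0 c₃≡0)) ⟩
    0ℚ ∎

-- The facet inequalities of the dilated tetrahedron, except z ≥ 0, which is built into l : ℕ.
InTet : ℕ → ℕ → ℕ → ℕ → ℕ → Set
InTet μ t i j l = l ℕ.≤ suc μ ℕ.* i × l ℕ.≤ suc μ ℕ.* j × suc μ ℕ.* (i ℕ.+ j) ℕ.≤ l ℕ.+ suc μ ℕ.* t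

ℕ→ℚ-cancel-≤ : ∀ m n → ℕ→ℚ m ≤ ℕ→ℚ n → m ℕ.≤ n
ℕ→ℚ-cancel-≤ m n le = ℤₚ.drop‿+≤+ (ℤ→ℚ-cancel-≤ (ℤ.+ m) (ℤ.+ n) le)

nonneg⇒pos : ∀ z → 0ℚ ≤ ℤ→ℚ z → ∃ λ i → z ≡ ℤ.+ i
nonneg⇒pos z 0≤z with ℤ→ℚ-cancel-≤ (ℤ.+ 0) z 0≤z
... | +≤+ {n = i} _ = i , refl

module _ (μ t : ℕ) where

  private
    M τ : ℚ
    M = ℕ→ℚ (suc μ)
    τ = ℕ→ℚ t
    0≤M : 0ℚ ≤ M
    0≤M = 0≤ℕ→ℚ (suc μ)
    0≤τ : 0ℚ ≤ τ
    0≤τ = 0≤ℕ→ℚ t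

  -- Each of the last three expressions is tM times a barycentric coordinate, hence nonnegative; the
  -- first three allow x, y, z to be replaced by natural numbers.
  inDilate-tet-barycentric : ∀ x y z → InDilate (tet μ) t (x ∷ y ∷ z ∷ []) →
    0ℚ ≤ ℤ→ℚ x × 0ℚ ≤ ℤ→ℚ y × 0ℚ ≤ ℤ→ℚ z ×
    0ℚ ≤ M * ℤ→ℚ x - ℤ→ℚ z × 0ℚ ≤ M * ℤ→ℚ y - ℤ→ℚ z ×
    0ℚ ≤ ℤ→ℚ z + M * τ - M * (ℤ→ℚ x + ℤ→ℚ y)
  inDilate-tet-barycentric x y z (w , 0≤w , Σw≡1 , eq) =
    subst (0ℚ ≤_) (sym X≡) (*-nonneg 0≤τ (+-nonneg (0≤w (suc zero)) (0≤w (suc (suc (suc zero)))))) ,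
    subst (0ℚ ≤_) (sym Y≡) (*-nonneg 0≤τ (+-nonneg (0≤w (suc (suc zero))) (0≤w (suc (suc (suc zero)))))) ,
    subst (0ℚ ≤_) (sym Z≡) (*-nonneg 0≤τ (*-nonneg 0≤M (0≤w (suc (suc (suc zero)))))) ,
    subst (0ℚ ≤_) (sym MX-Z≡) (*-nonneg (*-nonneg 0≤τ 0≤M) (0≤w (suc zero))) ,
    subst (0ℚ ≤_) (sym MY-Z≡) (*-nonneg (*-nonneg 0≤τ 0≤M) (0≤w (suc (suc zero)))) ,
    subst (0ℚ ≤_) (sym slack≡) (*-nonneg (*-nonneg 0≤τ 0≤M) (0≤w zero))
    where
    open ≡-Reasoning
    a b c d : ℚ
    a = w zero
    b = w (suc zero)
    c = w (suc (suc zero))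
    d = w (suc (suc (suc zero)))
    X≡ : ℤ→ℚ x ≡ τ * (b + d)
    X≡ = trans (eq zero)
      (solve 5 (λ a b c d τ → a :* (τ :* con 0ℚ) :+ (b :* (τ :* con 1ℚ) :+ (c :* (τ :* con 0ℚ) :+ (d :* (τ :* con 1ℚ) :+ con 0ℚ)))
                              := τ :* (b :+ d)) refl a b c d τ)
    Y≡ : ℤ→ℚ y ≡ τ * (c + d)
    Y≡ = trans (eq (suc zero))
      (solve 5 (λ a b c d τ → a :* (τ :* con 0ℚ) :+ (b :* (τ :* con 0ℚ) :+ (c :* (τ :* con 1ℚ) :+ (d :* (τ :* con 1ℚ) :+ con 0ℚ)))
                              := τ :* (c :+ d)) refl a b c d τ)
    Z≡ : ℤ→ℚ z ≡ τ * (M * d)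
    Z≡ = trans (eq (suc (suc zero)))
      (solve 6 (λ a b c d τ M → a :* (τ :* con 0ℚ) :+ (b :* (τ :* con 0ℚ) :+ (c :* (τ :* con 0ℚ) :+ (d :* (τ :* M) :+ con 0ℚ)))
                                := τ :* (M :* d)) refl a b c d τ M)
    MX-Z≡ : M * ℤ→ℚ x - ℤ→ℚ z ≡ τ * M * b
    MX-Z≡ = trans (cong₂ (λ p q → M * p - q) X≡ Z≡)
      (solve 4 (λ M τ b d → M :* (τ :* (b :+ d)) :- τ :* (M :* d) := τ :* M :* b) refl M τ b d)
    MY-Z≡ : M * ℤ→ℚ y - ℤ→ℚ z ≡ τ * M * c
    MY-Z≡ = trans (cong₂ (λ p q → M * p - q) Y≡ Z≡)
      (solve 4 (λ M τ b d → M :* (τ :* (b :+ d)) :- τ :* (M :* d) := τ :* M :* b) refl M τ c d)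
    slack≡ : ℤ→ℚ z + M * τ - M * (ℤ→ℚ x + ℤ→ℚ y) ≡ τ * M * a
    slack≡ = begin
      ℤ→ℚ z + M * τ - M * (ℤ→ℚ x + ℤ→ℚ y)
        ≡⟨ cong₂ (λ p q → p + M * τ - M * q) Z≡ (cong₂ _+_ X≡ Y≡) ⟩
      τ * (M * d) + M * τ - M * (τ * (b + d) + τ * (c + d))
        ≡⟨ cong (λ s → τ * (M * d) + s - M * (τ * (b + d) + τ * (c + d)))
             (trans (sym (*-identityʳ (M * τ))) (cong (M * τ *_) (sym Σw≡1))) ⟩
      τ * (M * d) + M * τ * (a + (b + (c + (d + 0ℚ)))) - M * (τ * (b + d) + τ * (c + d))
        ≡⟨ solve 6 (λ a b c d τ M → τ :* (M :* d) :+ M :* τ :* (a :+ (b :+ (c :+ (d :+ con 0ℚ)))) :- M :* (τ :* (b :+ d) :+ τ :* (c :+ d))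
                                    := τ :* M :* a) refl a b c d τ M ⟩
      τ * M * a ∎

  inDilate-tet⁻ : ∀ x y z → InDilate (tet μ) t (x ∷ y ∷ z ∷ []) →
    ∃ λ i → ∃ λ j → ∃ λ l → x ≡ ℤ.+ i × y ≡ ℤ.+ j × z ≡ ℤ.+ l × InTet μ t i j l
  inDilate-tet⁻ x y z ∈tet =
    let 0≤x , 0≤y , 0≤z , f₁ , f₂ , f₀ = inDilate-tet-barycentric x y z ∈tet in
    naturals (nonneg⇒pos x 0≤x) (nonneg⇒pos y 0≤y) (nonneg⇒pos z 0≤z) f₁ f₂ f₀
    where
    naturals : (∃ λ i → x ≡ ℤ.+ i) → (∃ λ j → y ≡ ℤ.+ j) → (∃ λ l → z ≡ ℤ.+ l) →
      0ℚ ≤ M * ℤ→ℚ x - ℤ→ℚ z → 0ℚ ≤ M * ℤ→ℚ y - ℤ→ℚ z →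
      0ℚ ≤ ℤ→ℚ z + M * τ - M * (ℤ→ℚ x + ℤ→ℚ y) →
      ∃ λ i → ∃ λ j → ∃ λ l → x ≡ ℤ.+ i × y ≡ ℤ.+ j × z ≡ ℤ.+ l × InTet μ t i j l
    naturals (i , refl) (j , refl) (l , refl) f₁ f₂ f₀ = i , j , l , refl , refl , refl ,
      ℕ→ℚ-cancel-≤ l (suc μ ℕ.* i) (subst (ℕ→ℚ l ≤_) (sym (ℕ→ℚ-* (suc μ) i)) (0≤q-p⇒p≤q f₁)) ,
      ℕ→ℚ-cancel-≤ l (suc μ ℕ.* j) (subst (ℕ→ℚ l ≤_) (sym (ℕ→ℚ-* (suc μ) j)) (0≤q-p⇒p≤q f₂)) ,
      ℕ→ℚ-cancel-≤ (suc μ ℕ.* (i ℕ.+ j)) (l ℕ.+ suc μ ℕ.* t)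
        (subst₂ _≤_ (sym (trans (ℕ→ℚ-* (suc μ) (i ℕ.+ j)) (cong (M *_) (ℕ→ℚ-+ i j))))
                    (sym (trans (ℕ→ℚ-+ l (suc μ ℕ.* t)) (cong (ℕ→ℚ l +_) (ℕ→ℚ-* (suc μ) t))))
                    (0≤q-p⇒p≤q f₀))

  inDilate-tet⁺ : 1 ℕ.≤ t → ∀ i j l → InTet μ t i j l →
                  InDilate (tet μ) t (ℤ.+ i ∷ ℤ.+ j ∷ ℤ.+ l ∷ [])
  inDilate-tet⁺ 1≤t i j l (l≤Mi , l≤Mj , Mij≤) = w , 0≤w , Σw≡1 ,
    λ { zero → X≡ ; (suc zero) → Y≡ ; (suc (suc zero)) → Z≡ }
    where
    D : ℚ
    D = M * τ
    0<D : 0ℚ < D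
    0<D = *-pos (0<ℕ→ℚ-suc μ) (<-≤-trans 0<1 (ℕ→ℚ-mono-≤ 1 t 1≤t))
    instance
      D-pos : Positive D
      D-pos = positive 0<D
      D-nonZero : NonZero D
      D-nonZero = pos⇒nonZero D
    r x y z : ℚ
    r = 1/ D
    x = ℕ→ℚ i
    y = ℕ→ℚ j
    z = ℕ→ℚ l
    0≤r : 0ℚ ≤ r
    0≤r = <⇒≤ (positive⁻¹ (1/ D) {{1/pos⇒pos D}})
    Dr≡1 : D * r ≡ 1ℚ
    Dr≡1 = *-inverseʳ D
    w : Fin 4 → ℚ
    -- The barycentric coordinates: the facet slacks divided by Mt, which 1 ≤ t makes positive.
    w zero                   = (z + D - M * (x + y)) * r
    w (suc zero)             = (M * x - z) * r
    w (suc (suc zero))       = (M * y - z) * r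
    w (suc (suc (suc zero))) = z * r
    0≤w : ∀ i → 0ℚ ≤ w i
    0≤w zero = *-nonneg (p≤q⇒0≤q-p (subst₂ _≤_
      (trans (ℕ→ℚ-* (suc μ) (i ℕ.+ j)) (cong (M *_) (ℕ→ℚ-+ i j)))
      (trans (ℕ→ℚ-+ l (suc μ ℕ.* t)) (cong (z +_) (ℕ→ℚ-* (suc μ) t)))
      (ℕ→ℚ-mono-≤ (suc μ ℕ.* (i ℕ.+ j)) (l ℕ.+ suc μ ℕ.* t) Mij≤))) 0≤r
    0≤w (suc zero) = *-nonneg (p≤q⇒0≤q-p (subst (z ≤_) (ℕ→ℚ-* (suc μ) i) (ℕ→ℚ-mono-≤ l (suc μ ℕ.* i) l≤Mi))) 0≤r
    0≤w (suc (suc zero)) = *-nonneg (p≤q⇒0≤q-p (subst (z ≤_) (ℕ→ℚ-* (suc μ) j) (ℕ→ℚ-mono-≤ l (suc μ ℕ.* j) l≤Mj))) 0≤r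
    0≤w (suc (suc (suc zero))) = *-nonneg (0≤ℕ→ℚ l) 0≤r
    scale : ∀ v → v ≡ v * (D * r)
    scale v = sym (trans (cong (v *_) Dr≡1) (*-identityʳ v))
    Σw≡1 : sumℚ w ≡ 1ℚ
    Σw≡1 = trans
      (solve 6 (λ x y z M D r → (z :+ D :- M :* (x :+ y)) :* r :+ ((M :* x :- z) :* r :+ ((M :* y :- z) :* r :+ (z :* r :+ con 0ℚ)))
                                := D :* r) refl x y z M D r)
      Dr≡1
    X≡ : x ≡ sumℚ (λ k → w k * (τ * ℤ→ℚ (lookup (tet μ k) zero)))
    X≡ = trans (scale x)
      (solve 6 (λ x y z M τ r → x :* (M :* τ :* r) :=
        (z :+ M :* τ :- M :* (x :+ y)) :* r :* (τ :* con 0ℚ) :+ ((M :* x :- z) :* r :* (τ :* con 1ℚ) :+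
        ((M :* y :- z) :* r :* (τ :* con 0ℚ) :+ (z :* r :* (τ :* con 1ℚ) :+ con 0ℚ)))) refl x y z M τ r)
    Y≡ : y ≡ sumℚ (λ k → w k * (τ * ℤ→ℚ (lookup (tet μ k) (suc zero))))
    Y≡ = trans (scale y)
      (solve 6 (λ x y z M τ r → y :* (M :* τ :* r) :=
        (z :+ M :* τ :- M :* (x :+ y)) :* r :* (τ :* con 0ℚ) :+ ((M :* x :- z) :* r :* (τ :* con 0ℚ) :+
        ((M :* y :- z) :* r :* (τ :* con 1ℚ) :+ (z :* r :* (τ :* con 1ℚ) :+ con 0ℚ)))) refl x y z M τ r)
    Z≡ : z ≡ sumℚ (λ k → w k * (τ * ℤ→ℚ (lookup (tet μ k) (suc (suc zero)))))
    Z≡ = trans (scale z)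
      (solve 6 (λ x y z M τ r → z :* (M :* τ :* r) :=
        (z :+ M :* τ :- M :* (x :+ y)) :* r :* (τ :* con 0ℚ) :+ ((M :* x :- z) :* r :* (τ :* con 0ℚ) :+
        ((M :* y :- z) :* r :* (τ :* con 0ℚ) :+ (z :* r :* (τ :* M) :+ con 0ℚ)))) refl x y z M τ r)

  -- Eliminating l: M(i + j) ≤ l + Mt ≤ Mj + Mt. With its mirror image this bounds the projection by
  -- the square of side t.
  inTet⇒i≤t : ∀ {i j l} → InTet μ t i j l → i ℕ.≤ t
  inTet⇒i≤t {i} {j} {l} (_ , l≤Mj , Mij≤) = ℕₚ.+-cancelʳ-≤ j i t (ℕₚ.*-cancelˡ-≤ (suc μ) (begin
    suc μ ℕ.* (i ℕ.+ j)             ≤⟨ Mij≤ ⟩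
    l ℕ.+ suc μ ℕ.* t               ≤⟨ ℕₚ.+-monoˡ-≤ (suc μ ℕ.* t) l≤Mj ⟩
    suc μ ℕ.* j ℕ.+ suc μ ℕ.* t     ≡⟨ ℕₚ.*-distribˡ-+ (suc μ) j t ⟨
    suc μ ℕ.* (j ℕ.+ t)             ≡⟨ cong (suc μ ℕ.*_) (ℕₚ.+-comm j t) ⟩
    suc μ ℕ.* (t ℕ.+ j)             ∎))
    where open ℕₚ.≤-Reasoning

  inTet-sym : ∀ {i j l} → InTet μ t i j l → InTet μ t j i l
  inTet-sym {i} {j} {l} (l≤Mi , l≤Mj , Mij≤) =
    l≤Mj , l≤Mi , subst (λ s → suc μ ℕ.* s ℕ.≤ l ℕ.+ suc μ ℕ.* t) (ℕₚ.+-comm i j) Mij≤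

  -- Ends of the vertical segment above (i, j). The truncation in `low` encodes the facet z ≥ 0.
  low high : ℕ → ℕ → ℕ
  low  i j = suc μ ℕ.* (i ℕ.+ j ∸ t)
  high i j = suc μ ℕ.* (i ⊓ j)

  high∸low : ∀ i j → high i j ∸ low i j ≡ suc μ ℕ.* tetHeight t i j
  high∸low i j = sym (ℕₚ.*-distribˡ-∸ (suc μ) (i ⊓ j) (i ℕ.+ j ∸ t))

  inTet⁺ : ∀ {i j l} → low i j ℕ.≤ l → l ℕ.≤ high i j → InTet μ t i j l
  inTet⁺ {i} {j} {l} low≤l l≤high =
    ℕₚ.≤-trans l≤high (ℕₚ.*-monoʳ-≤ (suc μ) (ℕₚ.m⊓n≤m i j)) ,
    ℕₚ.≤-trans l≤high (ℕₚ.*-monoʳ-≤ (suc μ) (ℕₚ.m⊓n≤n i j)) ,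
    subst (suc μ ℕ.* (i ℕ.+ j) ℕ.≤_) (ℕₚ.+-comm (suc μ ℕ.* t) l)
      (ℕₚ.≤-trans (ℕₚ.m≤n+m∸n (suc μ ℕ.* (i ℕ.+ j)) (suc μ ℕ.* t))
        (ℕₚ.+-monoʳ-≤ (suc μ ℕ.* t) (subst (ℕ._≤ l) (ℕₚ.*-distribˡ-∸ (suc μ) (i ℕ.+ j) t) low≤l)))

  inTet⁻ : ∀ {i j l} → InTet μ t i j l → low i j ℕ.≤ l × l ℕ.≤ high i j
  inTet⁻ {i} {j} {l} (l≤Mi , l≤Mj , Mij≤) =
    subst (ℕ._≤ l) (sym (ℕₚ.*-distribˡ-∸ (suc μ) (i ℕ.+ j) t))
      (ℕₚ.m≤n+o⇒m∸n≤o (suc μ ℕ.* (i ℕ.+ j)) (suc μ ℕ.* t)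
        (subst (suc μ ℕ.* (i ℕ.+ j) ℕ.≤_) (ℕₚ.+-comm l (suc μ ℕ.* t)) Mij≤)) ,
    subst (l ℕ.≤_) (sym (ℕₚ.*-distribˡ-⊓ (suc μ) i j)) (ℕₚ.⊓-glb l≤Mi l≤Mj)

  hasCard-tet : 1 ℕ.≤ t → HasCard (InDilate (tet μ) t) (sumℕ² (suc t) (λ i j → suc (suc μ ℕ.* tetHeight t i j)))
  hasCard-tet 1≤t = hasCard-∷ {S = InDilate (tet μ) t} ℤ.+_ ℤₚ.+-injective (suc t)
      (λ i → sumℕ (suc t) (count i)) (λ i i<1+t → slice i (ℕₚ.≤-pred i<1+t)) boundX
    where
    count : ℕ → ℕ → ℕ
    count i j = suc (suc μ ℕ.* tetHeight t i j)

    boundX : ∀ x p → InDilate (tet μ) t (x ∷ p) → ∃ λ i → i ℕ.< suc t × x ≡ ℤ.+ i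
    boundX x (y ∷ z ∷ []) ∈tet = let i , j , l , x≡ , _ , _ , inTet = inDilate-tet⁻ x y z ∈tet in
      i , s≤s (inTet⇒i≤t inTet) , x≡

    boundY : ∀ i y p → InDilate (tet μ) t (ℤ.+ i ∷ y ∷ p) → ∃ λ j → j ℕ.< suc t × y ≡ ℤ.+ j
    boundY i y (z ∷ []) ∈tet = let _ , j , l , _ , y≡ , _ , inTet = inDilate-tet⁻ (ℤ.+ i) y z ∈tet in
      j , s≤s (inTet⇒i≤t (inTet-sym inTet)) , y≡

    boundZ : ∀ i j z p → InDilate (tet μ) t (ℤ.+ i ∷ ℤ.+ j ∷ z ∷ p) →
             ∃ λ l → l ℕ.< count i j × z ≡ ℤ.+ (low i j ℕ.+ l)
    boundZ i j z [] ∈tet = natural (inDilate-tet⁻ (ℤ.+ i) (ℤ.+ j) z ∈tet)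
      where
      natural : (∃ λ i′ → ∃ λ j′ → ∃ λ l → ℤ.+ i ≡ ℤ.+ i′ × ℤ.+ j ≡ ℤ.+ j′ × z ≡ ℤ.+ l × InTet μ t i′ j′ l) →
                ∃ λ l → l ℕ.< count i j × z ≡ ℤ.+ (low i j ℕ.+ l)
      natural (_ , _ , l , refl , refl , refl , inTet) = let low≤l , l≤high = inTet⁻ inTet in
        l ∸ low i j ,
        s≤s (subst (l ∸ low i j ℕ.≤_) (high∸low i j) (ℕₚ.∸-monoˡ-≤ (low i j) l≤high)) ,
        cong ℤ.+_ (sym (ℕₚ.m+[n∸m]≡n low≤l))

    column : ∀ i j → i ℕ.≤ t → j ℕ.≤ t → HasCard (λ p → InDilate (tet μ) t (ℤ.+ i ∷ ℤ.+ j ∷ p)) (count i j)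
    column i j i≤t j≤t = subst (HasCard (λ p → InDilate (tet μ) t (ℤ.+ i ∷ ℤ.+ j ∷ p))) (trans (sumℕ-const (count i j) 1) (ℕₚ.*-identityʳ (count i j)))
      -- A column starts at `low i j` rather than at 0, hence the shifted enumeration.
      (hasCard-∷ {S = λ p → InDilate (tet μ) t (ℤ.+ i ∷ ℤ.+ j ∷ p)} (λ l → ℤ.+ (low i j ℕ.+ l))
        (λ {k} {l} eq → ℕₚ.+-cancelˡ-≡ (low i j) k l (ℤₚ.+-injective eq)) (count i j) (λ _ → 1)
        (λ l l<count → hasCard-[] {S = λ p → InDilate (tet μ) t (ℤ.+ i ∷ ℤ.+ j ∷ ℤ.+ (low i j ℕ.+ l) ∷ p)} (inDilate-tet⁺ 1≤t i j (low i j ℕ.+ l)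
          (inTet⁺ (ℕₚ.m≤m+n (low i j) l) (under (ℕₚ.≤-pred l<count)))))
        (boundZ i j))
      where
      under : ∀ {l} → l ℕ.≤ suc μ ℕ.* tetHeight t i j → low i j ℕ.+ l ℕ.≤ high i j
      under {l} l≤ = subst (low i j ℕ.+ l ℕ.≤_)
        (ℕₚ.m+[n∸m]≡n (ℕₚ.*-monoʳ-≤ (suc μ) (excess≤⊓ i≤t j≤t)))
        (ℕₚ.+-monoʳ-≤ (low i j) (subst (l ℕ.≤_) (sym (high∸low i j)) l≤))

    slice : ∀ i → i ℕ.≤ t → HasCard (λ p → InDilate (tet μ) t (ℤ.+ i ∷ p)) (sumℕ (suc t) (count i))
    slice i i≤t = hasCard-∷ {S = λ p → InDilate (tet μ) t (ℤ.+ i ∷ p)} ℤ.+_ ℤₚ.+-injective (suc t) (count i)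
      (λ j j<1+t → column i j i≤t (ℕₚ.≤-pred j<1+t)) (boundY i)

-- Coefficients of (t+1)² + (1+μ)(t³−t)/6, separated into const + μ slope.
tetConst tetSlope : ℕ → ℚ
tetConst 0 = 1ℚ
-- 2 from (t+1)², less 1/6 from (t³-t)/6.
tetConst 1 = ℤ.+ 11 / 6
tetConst 2 = 1ℚ
tetConst 3 = ℤ.+ 1 / 6
tetConst _ = 0ℚ
tetSlope 1 = - (ℤ.+ 1 / 6)
tetSlope 3 = ℤ.+ 1 / 6
tetSlope _ = 0ℚ

ehrhart-tet : ∀ μ → IsFullDimEhrhart 3 (λ k → tetConst k + ℕ→ℚ μ * tetSlope k)
ehrhart-tet μ = 4 , tet μ , (id , affIndep-tet μ) , degree ,
  λ t 1≤t → _ , hasCard-tet μ t 1≤t , evaluate t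
  where
  open ≡-Reasoning
  degree : ∀ k → 3 ℕ.< k → tetConst k + ℕ→ℚ μ * tetSlope k ≡ 0ℚ
  degree (suc (suc (suc (suc k)))) _ = trans (+-identityˡ (ℕ→ℚ μ * 0ℚ)) (*-zeroʳ (ℕ→ℚ μ))
  degree 1 (s≤s ())
  degree 2 (s≤s (s≤s ()))
  degree 3 (s≤s (s≤s (s≤s ())))
  evaluate : ∀ t → ℕ→ℚ (sumℕ² (suc t) (λ i j → suc (suc μ ℕ.* tetHeight t i j))) ≡
             sumℚ< 4 (λ k → (tetConst k + ℕ→ℚ μ * tetSlope k) * powℚ (ℕ→ℚ t) k)
  evaluate t = begin
    ℕ→ℚ (sumℕ² (suc t) (λ i j → 1 ℕ.+ suc μ ℕ.* tetHeight t i j))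
      ≡⟨ cong ℕ→ℚ (trans (sumℕ²-+ (suc t) (λ _ _ → 1) (λ i j → suc μ ℕ.* tetHeight t i j))
           (cong₂ ℕ._+_ (sumℕ²-1 (suc t)) (sumℕ²-*ˡ (suc t) (suc μ) (tetHeight t)))) ⟩
    ℕ→ℚ (suc t ℕ.* suc t ℕ.+ suc μ ℕ.* W)
      ≡⟨ trans (ℕ→ℚ-+ (suc t ℕ.* suc t) (suc μ ℕ.* W)) (cong₂ _+_ (ℕ→ℚ-* (suc t) (suc t)) (ℕ→ℚ-* (suc μ) W)) ⟩
    ℕ→ℚ (suc t) * ℕ→ℚ (suc t) + ℕ→ℚ (suc μ) * ℕ→ℚ W
      ≡⟨ cong₂ _+_ (cong₂ _*_ (ℕ→ℚ-suc t) (ℕ→ℚ-suc t)) (cong₂ _*_ (ℕ→ℚ-suc μ) W≡) ⟩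
    (1ℚ + τ) * (1ℚ + τ) + (1ℚ + ℕ→ℚ μ) * ((τ * τ * τ - τ) * (ℤ.+ 1 / 6))
      ≡⟨ solve 2 (λ τ μ → (con 1ℚ :+ τ) :* (con 1ℚ :+ τ) :+ (con 1ℚ :+ μ) :* ((τ :* τ :* τ :- τ) :* con (ℤ.+ 1 / 6)) :=
           con 0ℚ :+ (con 1ℚ :+ μ :* con 0ℚ) :* con 1ℚ
                  :+ (con (ℤ.+ 11 / 6) :+ μ :* con (- (ℤ.+ 1 / 6))) :* (τ :* con 1ℚ)
                  :+ (con 1ℚ :+ μ :* con 0ℚ) :* (τ :* (τ :* con 1ℚ))
                  :+ (con (ℤ.+ 1 / 6) :+ μ :* con (ℤ.+ 1 / 6)) :* (τ :* (τ :* (τ :* con 1ℚ)))) refl τ (ℕ→ℚ μ) ⟩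
    sumℚ< 4 (λ k → (tetConst k + ℕ→ℚ μ * tetSlope k) * powℚ τ k) ∎
    where
    τ = ℕ→ℚ t
    W = sumℕ² (suc t) (tetHeight t)
    6W+τ≡τ³ : ℕ→ℚ 6 * ℕ→ℚ W + τ ≡ τ * τ * τ
    6W+τ≡τ³ = begin
      ℕ→ℚ 6 * ℕ→ℚ W + τ          ≡⟨ cong (_+ τ) (ℕ→ℚ-* 6 W) ⟨
      ℕ→ℚ (6 ℕ.* W) + τ          ≡⟨ ℕ→ℚ-+ (6 ℕ.* W) t ⟨
      ℕ→ℚ (6 ℕ.* W ℕ.+ t)        ≡⟨ cong ℕ→ℚ (sumℕ²-tetHeight t) ⟩
      ℕ→ℚ (t ℕ.* t ℕ.* t)        ≡⟨ ℕ→ℚ-* (t ℕ.* t) t ⟩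
      ℕ→ℚ (t ℕ.* t) * τ          ≡⟨ cong (_* τ) (ℕ→ℚ-* t t) ⟩
      τ * τ * τ                  ∎
    W≡ : ℕ→ℚ W ≡ (τ * τ * τ - τ) * (ℤ.+ 1 / 6)
    W≡ = begin
      ℕ→ℚ W                                          ≡⟨ solve 2 (λ w τ → w := (con (ℕ→ℚ 6) :* w :+ τ :- τ) :* con (ℤ.+ 1 / 6)) refl (ℕ→ℚ W) τ ⟩
      (ℕ→ℚ 6 * ℕ→ℚ W + τ - τ) * (ℤ.+ 1 / 6)          ≡⟨ cong (λ x → (x - τ) * (ℤ.+ 1 / 6)) 6W+τ≡τ³ ⟩
      (τ * τ * τ - τ) * (ℤ.+ 1 / 6)                  ∎

-- Coefficient signs

-- The cross-multiplied form of i/(n+1) ≤ ∣i∣, valid as the denominator is at least 1.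
i≤∣i∣*suc : ∀ i n → i ℤ.* ℤ.+ 1 ℤ.≤ ℤ.+ ℤ.∣ i ∣ ℤ.* ℤ.+ suc n
i≤∣i∣*suc (ℤ.+ m)    n = subst₂ ℤ._≤_ (ℤₚ.pos-* m 1) (ℤₚ.pos-* m (suc n)) (+≤+ (ℕₚ.*-monoʳ-≤ m (s≤s z≤n)))
i≤∣i∣*suc ℤ.-[1+ m ] n = subst (ℤ.-[1+ m ] ℤ.* ℤ.+ 1 ℤ.≤_) (ℤₚ.pos-* (suc m) (suc n)) ℤ.-≤+

archimedean : ∀ p → ∃ λ n → p ≤ ℕ→ℚ n
archimedean p@(mkℚ i d-1 _) = ℤ.∣ i ∣ , toℚᵘ-cancel-≤ (begin
  toℚᵘ p                      ≤⟨ ℚᵘ.*≤* (i≤∣i∣*suc i d-1) ⟩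
  ℚᵘ.mkℚᵘ (ℤ.+ ℤ.∣ i ∣) 0     ≃⟨ toℚᵘ-fromℚᵘ (ℚᵘ.mkℚᵘ (ℤ.+ ℤ.∣ i ∣) 0) ⟨
  toℚᵘ (ℕ→ℚ ℤ.∣ i ∣)          ∎)
  where open ℚᵘₚ.≤-Reasoning

Eventually : (ℕ → Set) → Set
Eventually P = ∃ λ n₀ → ∀ n → n₀ ℕ.≤ n → P n

-- Finitely many thresholds have a maximum; this lets one length, one μ or one dilation serve all
-- coefficients.
eventually-∀≤ : ∀ {P : ℕ → ℕ → Set} e → (∀ k → k ℕ.≤ e → Eventually (P k)) →
                Eventually (λ n → ∀ k → k ℕ.≤ e → P k n)
eventually-∀≤ zero ev = let n₀ , p = ev 0 z≤n in n₀ , λ { n n₀≤n .0 z≤n → p n n₀≤n }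
eventually-∀≤ {P} (suc e) ev =
  let n₀ , p = ev (suc e) ℕₚ.≤-refl
      n₁ , q = eventually-∀≤ {P} e (λ k k≤e → ev k (ℕₚ.m≤n⇒m≤1+n k≤e))
  in n₀ ℕ.⊔ n₁ , λ n n₀₁≤n k k≤1+e →
       cases n k (p n (ℕₚ.≤-trans (ℕₚ.m≤m⊔n n₀ n₁) n₀₁≤n)) (q n (ℕₚ.≤-trans (ℕₚ.m≤n⊔m n₀ n₁) n₀₁≤n)) (ℕₚ.m≤n⇒m<n∨m≡n k≤1+e)
  where
  cases : ∀ n k → P (suc e) n → (∀ k → k ℕ.≤ e → P k n) → k ℕ.< suc e ⊎ k ≡ suc e → P k n
  cases n k p q (inj₁ k<1+e) = q k (ℕₚ.≤-pred k<1+e)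
  cases n k p q (inj₂ refl)  = p

eventually-pos : ∀ {x} y → 0ℚ < x → Eventually (λ n → 0ℚ < ℕ→ℚ n * x + y)
eventually-pos {x} y 0<x = let n₀ , bound = archimedean q in n₀ , λ n n₀≤n →
  <-≤-trans 0<x (subst (_≤ ℕ→ℚ n * x + y) q*x+y≡x
    (+-monoˡ-≤ y (*-monoʳ-≤-nonNeg x (≤-trans bound (ℕ→ℚ-mono-≤ n₀ n n₀≤n)))))
  where
  open ≡-Reasoning
  instance
    x-pos : Positive x
    x-pos = positive 0<x
    x-nonNeg : NonNegative x
    x-nonNeg = pos⇒nonNeg x
    x-nonZero : NonZero x
    x-nonZero = pos⇒nonZero x
  -- Solves q x + y = x, so any n ≥ q gives at least x, which is positive.
  q = 1ℚ - y * 1/ x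
  q*x+y≡x : q * x + y ≡ x
  q*x+y≡x = begin
    (1ℚ - y * 1/ x) * x + y      ≡⟨ solve 3 (λ x y r → (con 1ℚ :- y :* r) :* x :+ y := x :- y :* (r :* x) :+ y) refl x y (1/ x) ⟩
    x - y * (1/ x * x) + y       ≡⟨ cong (λ r → x - y * r + y) (*-inverseˡ x) ⟩
    x - y * 1ℚ + y               ≡⟨ solve 2 (λ x y → x :- y :* con 1ℚ :+ y := x) refl x y ⟩
    x                            ∎

eventually-neg : ∀ {x} y → x < 0ℚ → Eventually (λ n → ℕ→ℚ n * x + y < 0ℚ)
eventually-neg {x} y x<0 = let n₀ , pos = eventually-pos (- y) (neg-antimono-< x<0) in n₀ , λ n n₀≤n →
  subst (_< 0ℚ) (solve 3 (λ n x y → :- (n :* (:- x) :+ (:- y)) := n :* x :+ y) refl (ℕ→ℚ n) x y)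
    (neg-antimono-< (pos n n₀≤n))

nonneg+pos : ∀ {p q} → 0ℚ ≤ p → 0ℚ < q → 0ℚ < p + q
nonneg+pos = +-mono-≤-<

pos+nonneg : ∀ {p q} → 0ℚ < p → 0ℚ ≤ q → 0ℚ < p + q
pos+nonneg = +-mono-<-≤

-- Multiplication by a fixed polynomial is linear, so prisms preserve the form const + μ slope with
-- μ still free.
prismCoeff-linear : ∀ h (a b : ℕ → ℚ) μ k →
  prismCoeff h (λ k → a k + μ * b k) k ≡ prismCoeff h a k + μ * prismCoeff h b k
prismCoeff-linear h a b μ zero    = refl
prismCoeff-linear h a b μ (suc k) =
  solve 6 (λ a a′ b b′ μ H → a′ :+ μ :* b′ :+ H :* (a :+ μ :* b) := a′ :+ H :* a :+ μ :* (b′ :+ H :* b)) refl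
    (a k) (a (suc k)) (b k) (b (suc k)) μ (ℕ→ℚ (suc h))

-- One family for all μ, with the segment lengths already fixed. Slopes above r need only be
-- nonnegative, since T_m has slope 0 at t²; `const-pos` supplies strictness. `const-nonneg` reaches
-- past the degree because the top coefficient of a prism reads one index beyond it.
record TetPrismFamily (r : ℕ) : Set where
  field
    const slope : ℕ → ℚ
    ehrhart     : ∀ μ → IsFullDimEhrhart (2 ℕ.+ r) (λ k → const k + ℕ→ℚ μ * slope k)
    const-nonneg : ∀ k → 0ℚ ≤ const k
    const-pos    : ∀ k → k ℕ.≤ 2 ℕ.+ r → 0ℚ < const k
    slope-zero   : slope 0 ≡ 0ℚ
    slope-neg    : ∀ k → 1 ℕ.≤ k → k ℕ.≤ r → slope k < 0ℚ
    slope-nonneg : ∀ k → r ℕ.< k → 0ℚ ≤ slope k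

tetPrismFamily : ∀ A → TetPrismFamily (suc A)
tetPrismFamily zero = record
  { const = tetConst
  ; slope = tetSlope
  ; ehrhart = ehrhart-tet
  ; const-nonneg = const-nonneg
  ; const-pos = const-pos
  ; slope-zero = refl
  ; slope-neg = λ { 1 _ _ → negative⁻¹ (- (ℤ.+ 1 / 6)) ; (suc (suc _)) _ (s≤s ()) }
  ; slope-nonneg = λ { 1 (s≤s ()) ; 2 _ → ≤-refl ; 3 _ → nonNegative⁻¹ (ℤ.+ 1 / 6) ; (suc (suc (suc (suc _)))) _ → ≤-refl }
  }
  where
  const-pos : ∀ k → k ℕ.≤ 3 → 0ℚ < tetConst k
  const-pos 0 _ = 0<1
  const-pos 1 _ = positive⁻¹ (ℤ.+ 11 / 6)
  const-pos 2 _ = 0<1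
  const-pos 3 _ = positive⁻¹ (ℤ.+ 1 / 6)
  const-pos (suc (suc (suc (suc _)))) (s≤s (s≤s (s≤s ())))
  const-nonneg : ∀ k → 0ℚ ≤ tetConst k
  const-nonneg 0 = <⇒≤ (const-pos 0 z≤n)
  const-nonneg 1 = <⇒≤ (const-pos 1 (s≤s z≤n))
  const-nonneg 2 = <⇒≤ (const-pos 2 (s≤s (s≤s z≤n)))
  const-nonneg 3 = <⇒≤ (const-pos 3 ℕₚ.≤-refl)
  const-nonneg (suc (suc (suc (suc _)))) = ≤-refl
tetPrismFamily (suc A) = record
  { const = prismCoeff h const
  ; slope = prismCoeff h slope
  ; ehrhart = λ μ → ehrhart-resp (prismCoeff-linear h const slope (ℕ→ℚ μ)) (ehrhart-prism h (ehrhart μ))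
  ; const-nonneg = const-nonneg′
  ; const-pos = const-pos′
  ; slope-zero = slope-zero
  ; slope-neg = slope-neg′
  ; slope-nonneg = slope-nonneg′
  }
  where
  open TetPrismFamily (tetPrismFamily A)
  -- The guard 1 ≤ k stands inside the predicate because the index range begins at 0; the new slope
  -- at index 1 is treated separately.
  shiftDominates : Eventually (λ n → ∀ k → k ℕ.≤ suc A → 1 ℕ.≤ k → ℕ→ℚ n * slope k + slope (suc k) < 0ℚ)
  shiftDominates = eventually-∀≤ {λ k n → 1 ℕ.≤ k → ℕ→ℚ n * slope k + slope (suc k) < 0ℚ} (suc A)
    λ { zero    _     → 0 , λ _ _ ()
      ; (suc k) k≤1+A → let n₀ , neg = eventually-neg (slope (suc (suc k))) (slope-neg (suc k) (s≤s z≤n) k≤1+A) in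
                        n₀ , λ n n₀≤n _ → neg n n₀≤n }
  h = proj₁ shiftDominates
  H = ℕ→ℚ (suc h)
  const-nonneg′ : ∀ k → 0ℚ ≤ prismCoeff h const k
  const-nonneg′ zero    = const-nonneg 0
  const-nonneg′ (suc k) = +-nonneg (const-nonneg (suc k)) (*-nonneg (0≤ℕ→ℚ (suc h)) (const-nonneg k))
  const-pos′ : ∀ k → k ℕ.≤ 4 ℕ.+ A → 0ℚ < prismCoeff h const k
  const-pos′ zero    _           = const-pos 0 z≤n
  const-pos′ (suc k) (s≤s k≤3+A) = nonneg+pos (const-nonneg (suc k)) (*-pos (0<ℕ→ℚ-suc h) (const-pos k k≤3+A))
  slope-neg′ : ∀ k → 1 ℕ.≤ k → k ℕ.≤ 2 ℕ.+ A → prismCoeff h slope k < 0ℚ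
  -- As slope 0 vanishes, the prism leaves slope 1 unchanged whatever its length.
  slope-neg′ 1 _ _ = subst (_< 0ℚ)
    (trans (solve 2 (λ b H → b := b :+ H :* con 0ℚ) refl (slope 1) H) (cong (λ b₀ → slope 1 + H * b₀) (sym slope-zero)))
    (slope-neg 1 (s≤s z≤n) (s≤s z≤n))
  -- The case k = A gains the new index: slope (A+2) is nonnegative, but the large multiple of slope
  -- (A+1) outweighs it.
  slope-neg′ (suc (suc k)) _ (s≤s k≤1+A) = subst (_< 0ℚ) (+-comm (H * slope (suc k)) (slope (suc (suc k))))
    (proj₂ shiftDominates (suc h) (ℕₚ.n≤1+n h) (suc k) k≤1+A (s≤s z≤n))
  slope-nonneg′ : ∀ k → 2 ℕ.+ A ℕ.< k → 0ℚ ≤ prismCoeff h slope k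
  slope-nonneg′ (suc k) (s≤s 1+A<k) = +-nonneg (slope-nonneg (suc k) (ℕₚ.m<n⇒m<1+n 1+A<k))
    (*-nonneg (0≤ℕ→ℚ (suc h)) (slope-nonneg k 1+A<k))

SignChange : ℕ → ℕ → (ℕ → ℚ) → Set
SignChange r e c = (∀ k → 1 ℕ.≤ k → k ℕ.≤ r → c k < 0ℚ) × (∀ k → r ℕ.< k → k ℕ.≤ e → 0ℚ < c k)

-- Here μ is finally fixed: large enough for the negative slopes to beat the constants, while above
-- them a positive constant meets a nonnegative slope.
tetPrism-signChange : ∀ A → Σ (ℕ → ℚ) λ c → IsFullDimEhrhart (3 ℕ.+ A) c × SignChange (suc A) (3 ℕ.+ A) c
tetPrism-signChange A = (λ k → const k + ℕ→ℚ μ * slope k) , ehrhart μ , below , above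
  where
  open TetPrismFamily (tetPrismFamily A)
  slopeDominates : Eventually (λ n → ∀ k → k ℕ.≤ suc A → 1 ℕ.≤ k → ℕ→ℚ n * slope k + const k < 0ℚ)
  slopeDominates = eventually-∀≤ {λ k n → 1 ℕ.≤ k → ℕ→ℚ n * slope k + const k < 0ℚ} (suc A)
    λ { zero    _     → 0 , λ _ _ ()
      ; (suc k) k≤1+A → let n₀ , neg = eventually-neg (const (suc k)) (slope-neg (suc k) (s≤s z≤n) k≤1+A) in
                        n₀ , λ n n₀≤n _ → neg n n₀≤n }
  μ = proj₁ slopeDominates
  below : ∀ k → 1 ℕ.≤ k → k ℕ.≤ suc A → const k + ℕ→ℚ μ * slope k < 0ℚ
  below k 1≤k k≤1+A = subst (_< 0ℚ) (+-comm (ℕ→ℚ μ * slope k) (const k))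
    (proj₂ slopeDominates μ ℕₚ.≤-refl k k≤1+A 1≤k)
  above : ∀ k → suc A ℕ.< k → k ℕ.≤ 3 ℕ.+ A → 0ℚ < const k + ℕ→ℚ μ * slope k
  above k 1+A<k k≤3+A = pos+nonneg (const-pos k k≤3+A) (*-nonneg (0≤ℕ→ℚ μ) (slope-nonneg k 1+A<k))

-- Dilating first makes the coefficient of t^k outweigh that of t^(k-1), so that a further unit prism
-- keeps all signs.
signChange-prism : ∀ {r e c} → r ℕ.< e → IsFullDimEhrhart e c → SignChange r e c →
  Σ (ℕ → ℚ) λ c′ → IsFullDimEhrhart (suc e) c′ × SignChange r (suc e) c′
signChange-prism {r} {e} {c} r<e E@(_ , _ , _ , degree , _) (neg , pos) =
  prismCoeff 0 scaled , ehrhart-prism 0 (ehrhart-scale s E) , neg′ , pos′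
  where
  -- Nothing is asked when c (k+1) = 0, as happens at k = e; the new leading coefficient is handled
  -- apart.
  SameSign : ℕ → ℕ → Set
  SameSign k n = (c (suc k) < 0ℚ → ℕ→ℚ n * c (suc k) + c k < 0ℚ) × (0ℚ < c (suc k) → 0ℚ < ℕ→ℚ n * c (suc k) + c k)
  sameSign : ∀ k → Eventually (SameSign k)
  sameSign k with <-cmp (c (suc k)) 0ℚ
  ... | tri< lt _ ≯ = let n₀ , p = eventually-neg (c k) lt in n₀ , λ n n₀≤n → (λ _ → p n n₀≤n) , λ gt → contradiction gt ≯
  ... | tri≈ ≮ _ ≯  = 0 , λ _ _ → (λ lt → contradiction lt ≮) , λ gt → contradiction gt ≯
  ... | tri> ≮ _ gt = let n₀ , p = eventually-pos (c k) gt in n₀ , λ n n₀≤n → (λ lt → contradiction lt ≮) , λ _ → p n n₀≤n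
  allSameSign : Eventually (λ n → ∀ k → k ℕ.≤ e → SameSign k n)
  allSameSign = eventually-∀≤ {SameSign} e (λ k _ → sameSign k)
  s = proj₁ allSameSign
  S = ℕ→ℚ (suc s)
  scaled : ℕ → ℚ
  scaled k = powℚ S k * c k
  dominated : ∀ k → k ℕ.≤ e → SameSign k (suc s)
  dominated = proj₂ allSameSign (suc s) (ℕₚ.n≤1+n s)
  Sᵏ-pos : ∀ k → 0ℚ < powℚ S k
  Sᵏ-pos = powℚ-pos (0<ℕ→ℚ-suc s)
  factor : ∀ k → powℚ S k * (S * c (suc k) + c k) ≡ prismCoeff 0 scaled (suc k)
  factor k = solve 4 (λ p S x y → p :* (S :* x :+ y) := S :* p :* x :+ con 1ℚ :* (p :* y)) refl
    (powℚ S k) S (c (suc k)) (c k)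
  neg′ : ∀ k → 1 ℕ.≤ k → k ℕ.≤ r → prismCoeff 0 scaled k < 0ℚ
  neg′ (suc k) _ 1+k≤r = subst (_< 0ℚ) (factor k) (*-pos-neg (Sᵏ-pos k)
    (proj₁ (dominated k (ℕₚ.≤-trans (ℕₚ.n≤1+n k) (ℕₚ.≤-trans 1+k≤r (ℕₚ.<⇒≤ r<e)))) (neg (suc k) (s≤s z≤n) 1+k≤r)))
  pos′ : ∀ k → r ℕ.< k → k ℕ.≤ suc e → 0ℚ < prismCoeff 0 scaled k
  pos′ (suc k) r<1+k (s≤s k≤e) = subst (0ℚ <_) (factor k) (*-pos (Sᵏ-pos k) (inner (ℕₚ.m≤n⇒m<n∨m≡n k≤e)))
    where
    inner : k ℕ.< e ⊎ k ≡ e → 0ℚ < S * c (suc k) + c k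
    inner (inj₁ k<e)  = proj₂ (dominated k k≤e) (pos (suc k) r<1+k k<e)
    -- Beyond the degree c (e+1) = 0, so the new leading coefficient is a positive multiple of the
    -- old one.
    inner (inj₂ refl) = subst (0ℚ <_)
      (trans (solve 2 (λ S x → x := S :* con 0ℚ :+ x) refl S (c e)) (cong (λ x → S * x + c e) (sym (degree (suc e) ℕₚ.≤-refl))))
      (pos e r<e ℕₚ.≤-refl)

signChange-prisms : ∀ B {r e c} → r ℕ.< e → IsFullDimEhrhart e c → SignChange r e c →
  Σ (ℕ → ℚ) λ c′ → IsFullDimEhrhart (B ℕ.+ e) c′ × SignChange r (B ℕ.+ e) c′
signChange-prisms zero    {c = c} r<e E sgn = c , E , sgn
signChange-prisms (suc B) {e = e} r<e E sgn =
  let _ , E′ , sgn′ = signChange-prisms B r<e E sgn in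
  signChange-prism (ℕₚ.≤-trans r<e (ℕₚ.m≤n+m e B)) E′ sgn′

-- Here r counts the negative coefficients. For r ≥ 1 the tetrahedral prism already has dimension r
-- + 2, so exactly β unit prisms remain to be taken.
signChange-exists : ∀ β r → Σ (ℕ → ℚ) λ c →
  IsFullDimEhrhart (β ℕ.+ 2 ℕ.+ r) c × SignChange r (β ℕ.+ 2 ℕ.+ r) c
signChange-exists β (suc A) = subst (λ d → Σ (ℕ → ℚ) λ c → IsFullDimEhrhart d c × SignChange (suc A) d c)
  (trans (cong (β ℕ.+_) (sym (ℕₚ.+-suc 2 A))) (sym (ℕₚ.+-assoc β 2 (suc A))))
  (let _ , E , sgn = tetPrism-signChange A in signChange-prisms β (ℕₚ.n≤1+n (2 ℕ.+ A)) E sgn)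
signChange-exists β zero = subst (λ d → Σ (ℕ → ℚ) λ c → IsFullDimEhrhart d c × SignChange 0 d c)
  (trans (sym (ℕₚ.+-suc β 1)) (sym (ℕₚ.+-identityʳ (β ℕ.+ 2))))
  -- The start is the segment [0,1], the prism over a point: dimension 1 is the least with r < e.
  -- One more prism, β + 1 in all, makes up the dimension.
  (signChange-prisms (suc β) {0} {1} (s≤s z≤n) (ehrhart-prism 0 ehrhart-point)
    ((λ { (suc _) _ () }) , (λ { 1 _ _ → 0<1 ; (suc (suc _)) _ (s≤s ()) })))

theorem4p5 : (β d : ℕ) → 1 ℕ.≤ β → 1 ℕ.≤ d → β ℕ.+ 2 ℕ.≤ d →
    Σ ℕ λ N → Σ ℕ λ m → Σ (Fin m → Pt N) λ V →
    HasDim V d ×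
    (Σ (ℕ → ℚ) λ c →
    IsEhrhartPoly V d c ×
    ((k : ℕ) → d ∸ (β ℕ.+ 1) ℕ.≤ k → k ℕ.≤ d ∸ 2 → 0ℚ < c k) ×
    ((k : ℕ) → 1 ℕ.≤ k → k ℕ.≤ d ∸ (β ℕ.+ 2) → c k < 0ℚ))
theorem4p5 β d _ _ β+2≤d with ℕₚ.m≤n⇒∃[o]m+o≡n β+2≤d
... | r , refl =
  let c , (m , V , (f , indep) , ehrhart) , neg , pos = signChange-exists β r in
  β ℕ.+ 2 ℕ.+ r , m , V , ((f , indep) , λ g → ¬affIndep (β ℕ.+ 2 ℕ.+ r) (V ∘ g)) , c , ehrhart ,
  -- The positive range begins at d - β - 1 = r + 1 and extends to t^d, so the bound d - 2 is
  -- relaxed to d.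
  (λ k lo hi → pos k (subst (ℕ._≤ k) d∸[β+1]≡1+r lo) (ℕₚ.≤-trans hi (ℕₚ.m∸n≤m (β ℕ.+ 2 ℕ.+ r) 2))) ,
  λ k 1≤k hi → neg k 1≤k (subst (k ℕ.≤_) (ℕₚ.m+n∸m≡n (β ℕ.+ 2) r) hi)
  where
  d∸[β+1]≡1+r : β ℕ.+ 2 ℕ.+ r ∸ (β ℕ.+ 1) ≡ suc r
  d∸[β+1]≡1+r = trans (cong (_∸ (β ℕ.+ 1)) (trans (ℕₚ.+-assoc β 2 r) (sym (ℕₚ.+-assoc β 1 (suc r))))) (ℕₚ.m+n∸m≡n (β ℕ.+ 1) (suc r))
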